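{- Let $A=\mathbb{F}_q[t]$, where $q$ is a power of a prime $p$, let $d>1$ be an integer and let $c\in\mathbb{F}_q^*$. The monic irreducible polynomials of degree $d$ dividing $L_{d-1}-c$ are the same as those dividing $D_{d-1}+(-1)^dc$, and they are exactly the monic irreducible $\wp\in A$ of degree $d$ with $d\wp/dt=(-1)^{d-1}c$, i.e. the monic irreducible $\wp$ of the form $\wp=a^p+(-1)^{d-1}ct$ for some $a\in A$. Such primes exist only when $p$ divides $d$. When they exist, each divides $L_{d-1}-c$ with multiplicity at least $p-1$, and divides $D_{d-1}+(-1)^dc$ with multiplicity one.
   Context: For $n\ge 0$, $[n]:=t^{q^n}-t$. Set $L_0=D_0=1$ and, for $n\ge1$, $L_n=[n]L_{n-1}$ and $D_n=[n]D_{n-1}^q$. -}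

module Defs where

open import Data.Nat as ℕ using (ℕ; zero; suc)
open import Data.List using (List; []; _∷_; map; length)
open import Data.List.Membership.Propositional using (_∈_)
open import Data.List.Relation.Unary.Unique.Propositional using (Unique)
open import Data.Product using (Σ; _×_)
open import Data.Sum using (_⊎_)
open import Relation.Nullary using (¬_)
open import Relation.Binary.PropositionalEquality using (_≡_; _≢_)
open import Relation.Binary.Definitions using (DecidableEquality)
open import Algebra.Structures using (IsCommutativeRing)

record FiniteField : Set₁ where
  field
    Carrier : Set
    _+_ _*_ : Carrier → Carrier → Carrier
    -_      : Carrier → Carrier
    0# 1#   : Carrier
    isCommutativeRing : IsCommutativeRing _≡_ _+_ _*_ -_ 0# 1#
    1≢0     : 1# ≢ 0#
    inverse : ∀ x → x ≢ 0# → Σ Carrier (λ y → x * y ≡ 1#)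
    _≟_     : DecidableEquality Carrier
    elements : List Carrier
    complete : ∀ x → x ∈ elements
    unique   : Unique elements

  infixl 6 _+_
  infixl 7 _*_

  card : ℕ
  card = length elements

  natC : ℕ → Carrier
  natC zero = 0#
  natC (suc n) = 1# + natC n

  powC : Carrier → ℕ → Carrier
  powC x zero = 1#
  powC x (suc n) = x * powC x n

-- Polynomials over a finite field: coefficient lists, lowest degree first.
module Poly (F : FiniteField) where
  open FiniteField F

  P : Set
  P = List Carrier

  coeff : P → ℕ → Carrier
  coeff [] i = 0#
  coeff (a ∷ f) zero = a
  coeff (a ∷ f) (suc i) = coeff f i

  _≈ₚ_ : P → P → Set
  f ≈ₚ g = ∀ i → coeff f i ≡ coeff g i

  _+ₚ_ : P → P → P
  [] +ₚ g = g
  (a ∷ f) +ₚ [] = a ∷ f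
  (a ∷ f) +ₚ (b ∷ g) = (a + b) ∷ (f +ₚ g)

  scale : Carrier → P → P
  scale c f = map (c *_) f

  _*ₚ_ : P → P → P
  [] *ₚ g = []
  (a ∷ f) *ₚ g = scale a g +ₚ (0# ∷ (f *ₚ g))

  -ₚ_ : P → P
  -ₚ f = map -_ f

  _-ₚ_ : P → P → P
  f -ₚ g = f +ₚ (-ₚ g)

  const : Carrier → P
  const c = c ∷ []

  T : P
  T = 0# ∷ 1# ∷ []

  _^ₚ_ : P → ℕ → P
  f ^ₚ zero = const 1#
  f ^ₚ suc n = f *ₚ (f ^ₚ n)

  infixl 6 _+ₚ_ _-ₚ_
  infixl 7 _*ₚ_
  infixr 8 _^ₚ_

  _∣ₚ_ : P → P → Set
  f ∣ₚ g = Σ P (λ h → (h *ₚ f) ≈ₚ g)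

  IsUnit : P → Set
  IsUnit f = Σ P (λ g → (g *ₚ f) ≈ₚ const 1#)

  Irreducible : P → Set
  Irreducible f = (¬ IsUnit f) × (∀ g h → (g *ₚ h) ≈ₚ f → IsUnit g ⊎ IsUnit h)

  MonicOfDegree : ℕ → P → Set
  MonicOfDegree d f = (coeff f d ≡ 1#) × (∀ i → d ℕ.< i → coeff f i ≡ 0#)

  derivAux : ℕ → P → P
  derivAux k [] = []
  derivAux k (a ∷ f) = (natC k * a) ∷ derivAux (suc k) f

  deriv : P → P
  deriv [] = []
  deriv (a ∷ f) = derivAux 1 f

  bracket : ℕ → P
  bracket n = (T ^ₚ (card ℕ.^ n)) -ₚ T

  Lp : ℕ → P
  Lp zero = const 1#
  Lp (suc n) = bracket (suc n) *ₚ Lp n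

  Dp : ℕ → P
  Dp zero = const 1#
  Dp (suc n) = bracket (suc n) *ₚ (Dp n ^ₚ card)

{-# OPTIONS --safe #-}
module Submission where

-- Write T for the variable, θᵢ = T^(q^i), and n = d - 1. If ℘ is monic irreducible of degree d, then
-- θ₁ , … , θ_d are roots of ℘(X) modulo ℘^q, since ℘(θᵢ) = ℘^(q^i), and their differences are prime
-- to ℘, because ℘ divides no T^(q^m) - T with 0 < m < d. Hence ℘(X) ≡ ∏ (X - θᵢ) modulo ℘^q, and
-- X = T gives the key congruence
--   ℘ ≡ (-1)^d [d] L_n   (mod ℘^q).
-- Differentiating it gives ℘′ ≡ (-1)^n L_n (mod ℘), and raising to the power q^n turns L_n into ± D_n
-- modulo ℘; this settles the equivalences. If ℘ = a^p + e T with e = (-1)^n c, then comparison of ℘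
-- with ℘^(q^d) gives ℘ ≡ - e [d] (mod ℘^p), so the key congruence yields ℘^(p-1) ∣ L_n - c. Finally
-- D_n′ = - D_(n-1)^q is prime to ℘, so ℘² cannot divide D_n + (-1)^d c.

open import Defs
open import Algebra.Bundles using (CommutativeRing; CommutativeMonoid)
open import Data.Empty using (⊥; ⊥-elim)
open import Data.Fin as Fin using (Fin; inject₁; fromℕ)
import Data.Fin.Properties as Finₚ
open import Data.Integer as ℤ using (ℤ; -[1+_]; _⊖_) renaming (+_ to pos)
import Data.Integer.Properties as ℤₚ
open import Data.List using (List; []; _∷_; length; map; filter; drop; replicate; _++_; applyUpTo; cartesianProductWith)
import Data.List.Properties as Listₚ
open import Data.List.Membership.Propositional using (_∈_)
import Data.List.Membership.Propositional.Properties as ∈ₚ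
open import Data.List.Membership.Propositional.Properties.WithK using (unique∧set⇒bag)
open import Data.List.Relation.Binary.BagAndSetEquality using (∼bag⇒↭)
open import Data.List.Relation.Binary.Permutation.Propositional as ↭ using (_↭_; ↭-sym)
open import Data.List.Relation.Binary.Permutation.Propositional.Properties using (↭-length)
open import Data.List.Relation.Unary.All as All using (All; []; _∷_)
import Data.List.Relation.Unary.All.Properties as Allₚ
open import Data.List.Relation.Unary.AllPairs as AllPairs using (AllPairs; []; _∷_)
import Data.List.Relation.Unary.AllPairs.Properties as AllPairsₚ
open import Data.List.Relation.Unary.Any using (here; there)
open import Data.List.Relation.Unary.Unique.Propositional using (Unique)
import Data.List.Relation.Unary.Unique.Propositional.Properties as Uniqueₚ
open import Data.Maybe using (Maybe; just; nothing)
open import Data.Nat as ℕ using (ℕ; zero; suc; s≤s; z≤n; _<_; _∸_)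
open import Data.Nat.Combinatorics using (_C_; nCn≡1; nC1≡n; nCk+nC[k+1]≡[n+1]C[k+1]; k>n⇒nCk≡0)
import Data.Nat.Coprimality as Coprimality
open import Data.Nat.Divisibility as ℕ∣ using () renaming (_∣_ to _∣ℕ_)
import Data.Nat.GCD as GCD
open import Data.Nat.Primality using (Prime; euclidsLemma; prime⇒irreducible; prime⇒nonTrivial)
import Data.Nat.Properties as ℕₚ
open import Data.Product using (Σ; _×_; ∃; proj₁; proj₂) renaming (_,_ to infixr 4 _,_)
open import Data.Sum using (_⊎_; inj₁; inj₂; [_,_]′)
open import Data.Vec as Vec using (Vec; []; _∷_)
import Data.Vec.Properties as Vecₚ
import Data.Vec.Relation.Unary.All as VecAll
open import Function.Bundles using (_⇔_; mk⇔; Equivalence)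
open import Function.Construct.Composition using (_⇔-∘_)
open import Function.Construct.Symmetry using (⇔-sym)
open import Level using (_⊔_; 0ℓ)
open import Relation.Binary.PropositionalEquality as ≡ using (_≡_; _≢_)
open import Relation.Nullary using (¬_; yes; no)
open import Relation.Nullary.Decidable using (¬?)

-- The congruences are proved in an arbitrary commutative ring with a derivation; coefficients,
-- degrees and Euclidean division enter only to supply the hypotheses. The obstacle is that modulo
-- ℘^q there are zero divisors, so distinctness of roots is replaced by differences that are units.
-- With that the factor theorem survives, and it serves three times: for ℘(X) modulo ℘^q; for
-- X^(q^m) - X modulo ℘, which would have q^d separated roots if ℘ divided T^(q^m) - T; and for X^q
-- - X modulo 0, that is, in A itself.
--
-- The last use makes q-th powers additive in A. Here q is just the number of elements of F and is
-- nowhere written as a power of p; instead X^q - X = ∏ (X - a) is seen to be invariant under X ↦ X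
-- + 1. For p-th powers the binomial theorem does the same job.
--
-- The exponent p - 1 arises because both congruences for ℘ are used modulo ℘^p, and comparing them
-- leaves a factor [d] in front of L_n - c; it contains ℘ exactly once, since [d]′ = -1.

module IntegerSolver {c ℓ} (R : CommutativeRing c ℓ) where
  open CommutativeRing R
  open import Algebra.Properties.Ring ring
  open import Algebra.Properties.Semiring.Mult.TCOptimised semiring using (1+×; ×-homo-+; ×1-homo-*) renaming (_×_ to _×′_)
  open import Algebra.Solver.Ring.AlmostCommutativeRing using (fromCommutativeRing; _-Raw-AlmostCommutative⟶_)
  open import Relation.Binary.Reasoning.Setoid setoid

  private
    ⟦_⟧ℤ : ℤ → Carrier
    ⟦ pos n ⟧ℤ = n ×′ 1#
    ⟦ -[1+ n ] ⟧ℤ = - (suc n ×′ 1#)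

    neg-homo : ∀ i → ⟦ ℤ.- i ⟧ℤ ≈ - ⟦ i ⟧ℤ
    neg-homo (pos zero) = sym -0#≈0#
    neg-homo (pos (suc n)) = refl
    neg-homo -[1+ n ] = sym (-‿involutive _)

    cancel-1 : ∀ x y → x - y ≈ (1# + x) - (1# + y)
    cancel-1 x y = begin
      x - y                       ≈⟨ +-congʳ (xyx⁻¹≈y 1# x) ⟨
      (1# + x - 1#) - y           ≈⟨ +-assoc _ _ _ ⟩
      (1# + x) + (- 1# + - y)     ≈⟨ +-congˡ (-‿+-comm 1# y) ⟩
      (1# + x) - (1# + y)         ∎

    ⊖-homo : ∀ m n → ⟦ m ⊖ n ⟧ℤ ≈ m ×′ 1# - n ×′ 1#
    ⊖-homo m zero = sym (trans (+-congˡ -0#≈0#) (+-identityʳ _))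
    ⊖-homo zero (suc n) = sym (+-identityˡ _)
    ⊖-homo (suc m) (suc n) = begin
      ⟦ suc m ⊖ suc n ⟧ℤ              ≡⟨ ≡.cong ⟦_⟧ℤ (ℤₚ.[1+m]⊖[1+n]≡m⊖n m n) ⟩
      ⟦ m ⊖ n ⟧ℤ                      ≈⟨ ⊖-homo m n ⟩
      m ×′ 1# - n ×′ 1#               ≈⟨ cancel-1 _ _ ⟩
      (1# + m ×′ 1#) - (1# + n ×′ 1#) ≈⟨ +-cong (1+× m 1#) (-‿cong (1+× n 1#)) ⟨
      suc m ×′ 1# - suc n ×′ 1#       ∎

    +-homo : ∀ i j → ⟦ i ℤ.+ j ⟧ℤ ≈ ⟦ i ⟧ℤ + ⟦ j ⟧ℤ
    +-homo (pos m) (pos n) = ×-homo-+ 1# m n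
    +-homo (pos m) -[1+ n ] = ⊖-homo m (suc n)
    +-homo -[1+ m ] (pos n) = trans (⊖-homo n (suc m)) (+-comm _ _)
    +-homo -[1+ m ] -[1+ n ] = begin
      - (suc (suc (m ℕ.+ n)) ×′ 1#)    ≡⟨ ≡.cong (λ k → - (suc k ×′ 1#)) (ℕₚ.+-suc m n) ⟨
      - ((suc m ℕ.+ suc n) ×′ 1#)      ≈⟨ -‿cong (×-homo-+ 1# (suc m) (suc n)) ⟩
      - (suc m ×′ 1# + suc n ×′ 1#)    ≈⟨ -‿+-comm _ _ ⟨
      - (suc m ×′ 1#) + - (suc n ×′ 1#) ∎

    pos-*-homo : ∀ m j → ⟦ pos m ℤ.* j ⟧ℤ ≈ ⟦ pos m ⟧ℤ * ⟦ j ⟧ℤ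
    pos-*-homo m (pos n) = begin
      ⟦ pos m ℤ.* pos n ⟧ℤ ≡⟨ ≡.cong ⟦_⟧ℤ (ℤₚ.pos-* m n) ⟨
      (m ℕ.* n) ×′ 1#      ≈⟨ ×1-homo-* m n ⟩
      m ×′ 1# * n ×′ 1#    ∎
    pos-*-homo m -[1+ n ] = begin
      ⟦ pos m ℤ.* -[1+ n ] ⟧ℤ             ≡⟨ ≡.cong ⟦_⟧ℤ (ℤₚ.neg-distribʳ-* (pos m) (pos (suc n))) ⟨
      ⟦ ℤ.- (pos m ℤ.* pos (suc n)) ⟧ℤ    ≈⟨ neg-homo (pos m ℤ.* pos (suc n)) ⟩
      - ⟦ pos m ℤ.* pos (suc n) ⟧ℤ        ≈⟨ -‿cong (pos-*-homo m (pos (suc n))) ⟩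
      - (m ×′ 1# * suc n ×′ 1#)           ≈⟨ -‿distribʳ-* _ _ ⟩
      m ×′ 1# * - (suc n ×′ 1#)           ∎
    *-homo : ∀ i j → ⟦ i ℤ.* j ⟧ℤ ≈ ⟦ i ⟧ℤ * ⟦ j ⟧ℤ
    *-homo (pos m) j = pos-*-homo m j
    *-homo -[1+ m ] j = begin
      ⟦ -[1+ m ] ℤ.* j ⟧ℤ             ≡⟨ ≡.cong ⟦_⟧ℤ (ℤₚ.neg-distribˡ-* (pos (suc m)) j) ⟨
      ⟦ ℤ.- (pos (suc m) ℤ.* j) ⟧ℤ    ≈⟨ neg-homo (pos (suc m) ℤ.* j) ⟩
      - ⟦ pos (suc m) ℤ.* j ⟧ℤ        ≈⟨ -‿cong (pos-*-homo (suc m) j) ⟩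
      - (suc m ×′ 1# * ⟦ j ⟧ℤ)        ≈⟨ -‿distribˡ-* _ _ ⟩
      - (suc m ×′ 1#) * ⟦ j ⟧ℤ        ∎

    morphism : ℤ.+-*-rawRing -Raw-AlmostCommutative⟶ fromCommutativeRing R
    morphism = record
      { ⟦_⟧ = ⟦_⟧ℤ ; +-homo = +-homo ; *-homo = *-homo
      ; -‿homo = neg-homo ; 0-homo = refl ; 1-homo = refl }

    -- Distinct integers may coincide in `R`, for instance in characteristic p, so unequal
    -- coefficients yield no verdict rather than a refutation.
    decide : ∀ i j → Maybe (⟦ i ⟧ℤ ≈ ⟦ j ⟧ℤ)
    decide i j with i ℤ.≟ j
    ... | yes ≡.refl = just refl
    ... | no _ = nothing

  open import Algebra.Solver.Ring ℤ.+-*-rawRing (fromCommutativeRing R) morphism decide public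
    using (solve; _:=_; _:+_; _:*_; _:-_; :-_; con; Polynomial)

  :1 : ∀ {n} → Polynomial n
  :1 = con (pos 1)

  :0 : ∀ {n} → Polynomial n
  :0 = con (pos 0)

-- Divisibility and invertibility modulo an element of a commutative ring.

module Divides {c ℓ} (R : CommutativeRing c ℓ) where
  open CommutativeRing R
  open IntegerSolver R
  open import Algebra.Definitions.RawMagma *-rawMagma using (_∣_; module _∣ʳ_) renaming (_,_ to _,ᵈ_) public
  open import Algebra.Properties.Semiring.Exp semiring using (_^_; ^-homo-*; ^-congˡ) public
  open import Relation.Binary.Reasoning.Setoid setoid

  ∣-resp : ∀ {m x y} → x ≈ y → m ∣ x → m ∣ y
  ∣-resp e (h ,ᵈ p) = h ,ᵈ trans p e

  ∣-refl : ∀ {m} → m ∣ m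
  ∣-refl = 1# ,ᵈ *-identityˡ _

  ∣0 : ∀ {m} → m ∣ 0#
  ∣0 = 0# ,ᵈ zeroˡ _

  ∣-trans : ∀ {m n x} → m ∣ n → n ∣ x → m ∣ x
  ∣-trans (h ,ᵈ p) (k ,ᵈ r) = k * h ,ᵈ trans (*-assoc _ _ _) (trans (*-congˡ p) r)

  ∣-+ : ∀ {m x y} → m ∣ x → m ∣ y → m ∣ x + y
  ∣-+ (h ,ᵈ p) (k ,ᵈ r) = h + k ,ᵈ trans (distribʳ _ _ _) (+-cong p r)

  ∣-*ˡ : ∀ {m x} z → m ∣ x → m ∣ z * x
  ∣-*ˡ z (h ,ᵈ p) = z * h ,ᵈ trans (*-assoc _ _ _) (*-congˡ p)

  ∣-*ʳ : ∀ {m x} z → m ∣ x → m ∣ x * z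
  ∣-*ʳ z d = ∣-resp (*-comm _ _) (∣-*ˡ z d)

  ∣-neg : ∀ {m x} → m ∣ x → m ∣ - x
  ∣-neg {m} {x} d = ∣-resp (solve 1 (λ x → :- :1 :* x := :- x) refl x) (∣-*ˡ (- 1#) d)

  ∣-sub : ∀ {m x y} → m ∣ x → m ∣ y → m ∣ x - y
  ∣-sub d e = ∣-+ d (∣-neg e)

  ∣-*-mono : ∀ {m n x y} → m ∣ x → n ∣ y → m * n ∣ x * y
  ∣-*-mono {m} {n} (h ,ᵈ p) (k ,ᵈ r) = h * k ,ᵈ
    trans (solve 4 (λ h k m n → (h :* k) :* (m :* n) := (h :* m) :* (k :* n)) refl h k m n) (*-cong p r)

  ∣-^-mono : ∀ {m x} n → m ∣ x → m ^ n ∣ x ^ n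
  ∣-^-mono zero d = ∣-refl
  ∣-^-mono (suc n) d = ∣-*-mono d (∣-^-mono n d)

  ^-∣ : ∀ m {i j} → i ℕ.≤ j → m ^ i ∣ m ^ j
  ^-∣ m {i} {j} i≤j = m ^ (j ℕ.∸ i) ,ᵈ
    trans (sym (^-homo-* m (j ℕ.∸ i) i)) (reflexive (≡.cong (m ^_) (ℕₚ.m∸n+n≡m i≤j)))

  ∣-x^ : ∀ {m} x n → 1 ℕ.≤ n → m ∣ x → m ∣ x ^ n
  ∣-x^ x (suc n) _ d = ∣-*ʳ (x ^ n) d

  ∣-^-sub : ∀ {m x y} n → m ∣ x - y → m ∣ x ^ n - y ^ n
  ∣-^-sub zero d = ∣-resp (sym (-‿inverseʳ 1#)) ∣0
  ∣-^-sub {m} {x} {y} (suc n) d = ∣-resp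
    (solve 4 (λ x y a b → (x :- y) :* a :+ y :* (a :- b) := x :* a :- y :* b) refl x y (x ^ n) (y ^ n))
    (∣-+ (∣-*ʳ (x ^ n) d) (∣-*ˡ y (∣-^-sub n d)))

  x^1≈x : ∀ x → x ^ 1 ≈ x
  x^1≈x = *-identityʳ

  1^n≈1 : ∀ n → 1# ^ n ≈ 1#
  1^n≈1 zero = refl
  1^n≈1 (suc n) = trans (*-identityˡ _) (1^n≈1 n)

  -- Means that `z` is a unit modulo `m`, which is what allows cancellation modulo ℘^q; for `m` = 0
  -- it says that `z` is a unit of the ring.
  Coprime : Carrier → Carrier → Set (c ⊔ ℓ)
  Coprime m z = ∃ λ u → m ∣ z * u - 1#

  coprime-cancel : ∀ {m z} w → Coprime m z → m ∣ z * w → m ∣ w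
  coprime-cancel {m} {z} w (u , d) e = ∣-resp
    (solve 3 (λ z u w → u :* (z :* w) :- w :* (z :* u :- :1) := w) refl z u w)
    (∣-sub (∣-*ˡ u e) (∣-*ˡ w d))

  coprime-1 : ∀ z → Coprime 1# z
  coprime-1 z = 0# , (_ ,ᵈ *-identityʳ _)

  -- The product of the defects z u - 1 and z v - 1 is, up to sign, again of the form z w - 1, and
  -- this w is the witness. It carries invertibility from ℘ to powers of ℘.
  coprime-*ˡ : ∀ {m n z} → Coprime m z → Coprime n z → Coprime (m * n) z
  coprime-*ˡ {m} {n} {z} (u , d) (v , e) = u + v - u * (z * v) , ∣-resp
    (solve 3 (λ z u v → :- ((z :* u :- :1) :* (z :* v :- :1)) := z :* (u :+ v :- u :* (z :* v)) :- :1) refl z u v)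
    (∣-neg (∣-*-mono d e))

  coprime-*ʳ : ∀ {m y z} → Coprime m y → Coprime m z → Coprime m (y * z)
  coprime-*ʳ {m} {y} {z} (u , d) (v , e) = u * v , ∣-resp
    (solve 4 (λ y z u v → (y :* u :- :1) :* (z :* v) :+ (z :* v :- :1) := (y :* z) :* (u :* v) :- :1) refl y z u v)
    (∣-+ (∣-*ʳ (z * v) d) e)

  coprime-^ˡ : ∀ {m z} n → Coprime m z → Coprime (m ^ n) z
  coprime-^ˡ zero _ = coprime-1 _
  coprime-^ˡ (suc n) κ = coprime-*ˡ κ (coprime-^ˡ n κ)

  coprime-^ʳ : ∀ {m z} n → Coprime m z → Coprime m (z ^ n)
  coprime-^ʳ {m} zero _ = 1# , ∣-resp (solve 0 (:0 := :1 :* :1 :- :1) refl) ∣0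
  coprime-^ʳ (suc n) κ = coprime-*ʳ κ (coprime-^ʳ n κ)

  coprime-resp : ∀ {m y z} → y ≈ z → Coprime m y → Coprime m z
  coprime-resp e (u , d) = u , ∣-resp (+-congʳ (*-congʳ e)) d

  coprime-≡ : ∀ {m y z} → m ∣ y - z → Coprime m y → Coprime m z
  coprime-≡ {m} {y} {z} e (u , d) = u , ∣-resp
    (solve 3 (λ y z u → (y :* u :- :1) :- (y :- z) :* u := z :* u :- :1) refl y z u) (∣-sub d (∣-*ʳ u e))

  coprime∣⇒∣1 : ∀ {m z} → Coprime m z → m ∣ z → m ∣ 1#
  coprime∣⇒∣1 {m} {z} (u , d) e = ∣-resp
    (solve 2 (λ z u → z :* u :- (z :* u :- :1) := :1) refl z u) (∣-sub (∣-*ʳ u e) d)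

  prod : (ℕ → Carrier) → ℕ → Carrier
  prod f zero = 1#
  prod f (suc n) = f 0 * prod (λ i → f (suc i)) n

  prod-cong : ∀ {f g} n → (∀ i → f i ≈ g i) → prod f n ≈ prod g n
  prod-cong zero e = refl
  prod-cong (suc n) e = *-cong (e 0) (prod-cong n (λ i → e (suc i)))

  prod-last : ∀ f n → prod f (suc n) ≈ f n * prod f n
  prod-last f zero = refl
  prod-last f (suc n) = begin
    f 0 * prod (λ i → f (suc i)) (suc n)            ≈⟨ *-congˡ (prod-last (λ i → f (suc i)) n) ⟩
    f 0 * (f (suc n) * prod (λ i → f (suc i)) n)    ≈⟨ solve 3 (λ a b c → a :* (b :* c) := b :* (a :* c)) refl (f 0) (f (suc n)) _ ⟩
    f (suc n) * prod f (suc n)                      ∎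

  prod-≡ : ∀ {m f g} n → (∀ i → m ∣ f i - g i) → m ∣ prod f n - prod g n
  prod-≡ zero e = ∣-resp (sym (-‿inverseʳ 1#)) ∣0
  prod-≡ {m} {f} {g} (suc n) e = ∣-resp
    (solve 4 (λ x y a b → (x :- y) :* a :+ y :* (a :- b) := x :* a :- y :* b) refl (f 0) (g 0) _ _)
    (∣-+ (∣-*ʳ _ (e 0)) (∣-*ˡ (g 0) (prod-≡ n (λ i → e (suc i)))))

  prod-neg : ∀ f n → prod (λ i → - f i) n ≈ (- 1#) ^ n * prod f n
  prod-neg f zero = sym (*-identityˡ 1#)
  prod-neg f (suc n) = begin
    - f 0 * prod (λ i → - f (suc i)) n                ≈⟨ *-congˡ (prod-neg (λ i → f (suc i)) n) ⟩
    - f 0 * ((- 1#) ^ n * prod (λ i → f (suc i)) n)   ≈⟨ solve 3 (λ a s b → :- a :* (s :* b) := (:- :1 :* s) :* (a :* b)) refl (f 0) ((- 1#) ^ n) _ ⟩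
    (- 1#) ^ suc n * prod f (suc n)                   ∎

-- The factor theorem for monic polynomials modulo an element.

module MonicPolynomials {c ℓ} (R : CommutativeRing c ℓ) where
  open CommutativeRing R
  open IntegerSolver R
  open Divides R
  open import Relation.Binary.Reasoning.Setoid setoid

  -- The vector (a₀ , … , aₙ₋₁) stands for the monic polynomial a₀ + a₁ X + ⋯ + aₙ₋₁ Xⁿ⁻¹ + Xⁿ.
  eval : ∀ {n} → Vec Carrier n → Carrier → Carrier
  eval [] x = 1#
  eval (a ∷ l) x = a + x * eval l x

  -- Synthetic division by X - x: the coefficients of the quotient are the Horner values at x.
  quotient : ∀ {n} → Carrier → Vec Carrier (suc n) → Vec Carrier n
  quotient x (a ∷ []) = []
  quotient x (a ∷ l@(_ ∷ _)) = eval l x ∷ quotient x l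

  eval-quotient : ∀ {n} x (l : Vec Carrier (suc n)) y →
                  eval l y ≈ eval l x + (y - x) * eval (quotient x l) y
  eval-quotient x (a ∷ []) y =
    solve 3 (λ a x y → a :+ y :* :1 := a :+ x :* :1 :+ (y :- x) :* :1) refl a x y
  eval-quotient x (a ∷ l@(_ ∷ _)) y = begin
    a + y * eval l y                                            ≈⟨ +-congˡ (*-congˡ (eval-quotient x l y)) ⟩
    a + y * (eval l x + (y - x) * eval (quotient x l) y)        ≈⟨ solve 5 (λ a x y f g →
                                                                     a :+ y :* (f :+ (y :- x) :* g) :=
                                                                     a :+ x :* f :+ (y :- x) :* (f :+ y :* g)) refl a x y (eval l x) _ ⟩
    a + x * eval l x + (y - x) * (eval l x + y * eval (quotient x l) y) ∎

  Separated : Carrier → List Carrier → Set _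
  Separated m = AllPairs (λ x y → Coprime m (y - x))

  -- If f = f(x) + (X - x) g and m divides f(x) and f(y), then m divides (y - x) g(y), where y - x
  -- is a unit modulo m.
  quotient-roots : ∀ {m n x xs} (l : Vec Carrier (suc n)) → m ∣ eval l x →
                   All (λ y → Coprime m (y - x)) xs → All (λ y → m ∣ eval l y) xs →
                   All (λ y → m ∣ eval (quotient x l) y) xs
  quotient-roots l r [] [] = []
  quotient-roots {x = x} l r (κ ∷ κs) (_∷_ {y} s ss) =
    coprime-cancel _ κ (∣-resp
      (trans (+-congʳ (eval-quotient x l y)) (solve 2 (λ a b → a :+ b :- a := b) refl (eval l x) _))
      (∣-sub s r))
    ∷ quotient-roots l r κs ss

  linearProduct : List Carrier → Carrier → Carrier
  linearProduct [] y = 1#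
  linearProduct (x ∷ xs) y = (y - x) * linearProduct xs y

  -- One linear factor is split off per root. When the roots are used up the remaining vector is
  -- empty, that is, the monic constant 1, so no cofactor is left.
  factorisation : ∀ {m n} xs (l : Vec Carrier n) → length xs ≡ n → Separated m xs →
                  All (λ x → m ∣ eval l x) xs → ∀ y → m ∣ eval l y - linearProduct xs y
  factorisation [] [] ≡.refl [] [] y = ∣-resp (sym (-‿inverseʳ 1#)) ∣0
  factorisation (x ∷ xs) l@(_ ∷ _) ≡.refl (κ ∷ κs) (r ∷ rs) y = ∣-resp
    (trans (solve 4 (λ a b g h → a :+ b :* (g :- h) := a :+ b :* g :- b :* h) refl (eval l x) (y - x) _ _)
           (+-congʳ (sym (eval-quotient x l y))))
    (∣-+ r (∣-*ˡ (y - x)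
      (factorisation xs (quotient x l) ≡.refl κs (quotient-roots l r κ rs) y)))

  -- With more roots than the degree, splitting off factors would end with the constant 1 having a
  -- root modulo m.
  root-bound : ∀ {m n} xs (l : Vec Carrier n) → ¬ m ∣ 1# → Separated m xs →
               All (λ x → m ∣ eval l x) xs → length xs ℕ.≤ n
  root-bound [] l m∤1 _ _ = z≤n
  root-bound (x ∷ xs) [] m∤1 _ (r ∷ _) = ⊥-elim (m∤1 r)
  root-bound (x ∷ xs) l@(_ ∷ _) m∤1 (κ ∷ κs) (r ∷ rs) =
    s≤s (root-bound xs (quotient x l) m∤1 κs (quotient-roots l r κ rs))

  linearProduct-applyUpTo : ∀ f n y → linearProduct (applyUpTo f n) y ≈ prod (λ i → y - f i) n
  linearProduct-applyUpTo f zero y = refl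
  linearProduct-applyUpTo f (suc n) y = *-congˡ (linearProduct-applyUpTo (λ i → f (suc i)) n y)

  monomial : ∀ n → Vec Carrier n
  monomial zero = []
  monomial (suc n) = 0# ∷ monomial n

  eval-monomial : ∀ n x → eval (monomial n) x ≈ x ^ n
  eval-monomial zero x = refl
  eval-monomial (suc n) x = trans (+-identityˡ _) (*-congˡ (eval-monomial n x))

  -- Note the shift: this is X^(n+2) - X. An exponent of at least two keeps the term - X away from
  -- the implicit leading term.
  X^_-X : ∀ n → Vec Carrier (suc (suc n))
  X^ n -X = 0# ∷ - 1# ∷ monomial n

  eval-X^n-X : ∀ n x → eval (X^ n -X) x ≈ x ^ suc (suc n) - x
  eval-X^n-X n x = begin
    0# + x * (- 1# + x * eval (monomial n) x) ≈⟨ +-congˡ (*-congˡ (+-congˡ (*-congˡ (eval-monomial n x)))) ⟩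
    0# + x * (- 1# + x * x ^ n)               ≈⟨ solve 2 (λ x y → :0 :+ x :* (:- :1 :+ x :* y) := x :* (x :* y) :- x) refl x (x ^ n) ⟩
    x ^ suc (suc n) - x                       ∎

-- Additive power maps.

module AdditivePowers {c ℓ} (R : CommutativeRing c ℓ) where
  open CommutativeRing R
  open IntegerSolver R
  open Divides R
  open MonicPolynomials R using (eval)
  open import Algebra.Properties.Semiring.Exp semiring using (^-assocʳ; ^-congʳ) public
  open import Algebra.Properties.CommutativeSemiring.Exp commutativeSemiring using (^-distrib-*) public
  open import Relation.Binary.Reasoning.Setoid setoid

  Additive : ℕ → Set _
  Additive n = ∀ x y → (x + y) ^ n ≈ x ^ n + y ^ n

  ^-^-comm : ∀ x m n → (x ^ m) ^ n ≈ (x ^ n) ^ m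
  ^-^-comm x m n = begin
    (x ^ m) ^ n    ≈⟨ ^-assocʳ x m n ⟩
    x ^ (m ℕ.* n)  ≈⟨ ^-congʳ x (ℕₚ.*-comm m n) ⟩
    x ^ (n ℕ.* m)  ≈⟨ ^-assocʳ x n m ⟨
    (x ^ n) ^ m    ∎

  -- Additivity is applied to (x - y) + y; expanding (- y)^n instead would raise the question of the
  -- parity of n.
  additive-sub : ∀ n → Additive n → ∀ x y → (x - y) ^ n ≈ x ^ n - y ^ n
  additive-sub n add x y = begin
    (x - y) ^ n                        ≈⟨ solve 2 (λ a b → a := a :+ b :- b) refl ((x - y) ^ n) (y ^ n) ⟩
    (x - y) ^ n + y ^ n - y ^ n        ≈⟨ +-congʳ (add (x - y) y) ⟨
    (x - y + y) ^ n - y ^ n            ≈⟨ +-congʳ (^-congˡ n (solve 2 (λ a b → a :- b :+ b := a) refl x y)) ⟩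
    x ^ n - y ^ n                      ∎

  additive-* : ∀ m n → Additive m → Additive n → Additive (m ℕ.* n)
  additive-* m n addm addn x y = begin
    (x + y) ^ (m ℕ.* n)              ≈⟨ ^-assocʳ _ m n ⟨
    ((x + y) ^ m) ^ n                ≈⟨ ^-congˡ n (addm x y) ⟩
    (x ^ m + y ^ m) ^ n              ≈⟨ addn _ _ ⟩
    (x ^ m) ^ n + (y ^ m) ^ n        ≈⟨ +-cong (^-assocʳ x m n) (^-assocʳ y m n) ⟩
    x ^ (m ℕ.* n) + y ^ (m ℕ.* n)    ∎

  additive-^ : ∀ m n → Additive m → Additive (m ℕ.^ n)
  additive-^ m zero _ x y = trans (x^1≈x _) (sym (+-cong (x^1≈x x) (x^1≈x y)))
  additive-^ m (suc n) add = additive-* m (m ℕ.^ n) add (additive-^ m n add)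

  fixed-^ : ∀ q {a} n → a ^ q ≈ a → a ^ (q ℕ.^ n) ≈ a
  fixed-^ q zero e = x^1≈x _
  fixed-^ q {a} (suc n) e = begin
    a ^ (q ℕ.* q ℕ.^ n)  ≈⟨ ^-assocʳ a q (q ℕ.^ n) ⟨
    (a ^ q) ^ (q ℕ.^ n)  ≈⟨ ^-congˡ (q ℕ.^ n) e ⟩
    a ^ (q ℕ.^ n)        ≈⟨ fixed-^ q n e ⟩
    a                    ∎

  -- An additive N-th power map is a ring endomorphism, and it fixes the coefficients. At x = T this
  -- gives ℘(T^N) = ℘^N.
  eval-^ : ∀ {n} N {l : Vec Carrier n} → Additive N → VecAll.All (λ a → a ^ N ≈ a) l →
           ∀ x → eval l (x ^ N) ≈ eval l x ^ N
  eval-^ N add VecAll.[] x = sym (1^n≈1 N)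
  eval-^ N {a ∷ l} add (e VecAll.∷ es) x = begin
    a + x ^ N * eval l (x ^ N)    ≈⟨ +-cong (sym e) (*-congˡ (eval-^ N add es x)) ⟩
    a ^ N + x ^ N * eval l x ^ N  ≈⟨ +-congˡ (^-distrib-* x _ N) ⟨
    a ^ N + (x * eval l x) ^ N    ≈⟨ add a _ ⟨
    (a + x * eval l x) ^ N        ∎

  prod-^ : ∀ f n k → prod f n ^ k ≈ prod (λ i → f i ^ k) n
  prod-^ f zero k = 1^n≈1 k
  prod-^ f (suc n) k = trans (^-distrib-* _ _ k) (*-congˡ (prod-^ (λ i → f (suc i)) n k))

-- Derivations of a commutative ring.

record IsDerivation {c ℓ} (R : CommutativeRing c ℓ) (δ : CommutativeRing.Carrier R → CommutativeRing.Carrier R) : Set (c ⊔ ℓ) where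
  open CommutativeRing R
  field
    δ-cong : ∀ {x y} → x ≈ y → δ x ≈ δ y
    δ-+ : ∀ x y → δ (x + y) ≈ δ x + δ y
    δ-* : ∀ x y → δ (x * y) ≈ δ x * y + x * δ y

module Derivation {c ℓ} {R : CommutativeRing c ℓ} {δ : CommutativeRing.Carrier R → CommutativeRing.Carrier R} (isDerivation : IsDerivation R δ) where
  open CommutativeRing R
  open IsDerivation isDerivation public
  open IntegerSolver R
  open Divides R
  open AdditivePowers R
  open import Algebra.Definitions.RawMonoid +-rawMonoid using () renaming (_×_ to _·_)
  open import Relation.Binary.Reasoning.Setoid setoid

  δ-0 : δ 0# ≈ 0#
  δ-0 = begin
    δ 0#                 ≈⟨ solve 1 (λ a → a := a :+ a :- a) refl (δ 0#) ⟩
    δ 0# + δ 0# - δ 0#   ≈⟨ +-congʳ (δ-+ 0# 0#) ⟨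
    δ (0# + 0#) - δ 0#   ≈⟨ +-congʳ (δ-cong (+-identityˡ 0#)) ⟩
    δ 0# - δ 0#          ≈⟨ -‿inverseʳ _ ⟩
    0#                   ∎

  δ-neg : ∀ x → δ (- x) ≈ - δ x
  δ-neg x = begin
    δ (- x)                ≈⟨ solve 2 (λ a b → a := a :+ b :- b) refl (δ (- x)) (δ x) ⟩
    δ (- x) + δ x - δ x    ≈⟨ +-congʳ (δ-+ (- x) x) ⟨
    δ (- x + x) - δ x      ≈⟨ +-congʳ (trans (δ-cong (-‿inverseˡ x)) δ-0) ⟩
    0# - δ x               ≈⟨ +-identityˡ _ ⟩
    - δ x                  ∎

  δ-sub : ∀ x y → δ (x - y) ≈ δ x - δ y
  δ-sub x y = trans (δ-+ x (- y)) (+-congˡ (δ-neg y))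

  δ-1 : δ 1# ≈ 0#
  δ-1 = begin
    δ 1#                               ≈⟨ solve 1 (λ a → a := a :* :1 :+ :1 :* a :- a) refl (δ 1#) ⟩
    δ 1# * 1# + 1# * δ 1# - δ 1#       ≈⟨ +-congʳ (δ-* 1# 1#) ⟨
    δ (1# * 1#) - δ 1#                 ≈⟨ +-congʳ (δ-cong (*-identityˡ 1#)) ⟩
    δ 1# - δ 1#                        ≈⟨ -‿inverseʳ _ ⟩
    0#                                 ∎

  δ-^ : ∀ x n → δ (x ^ suc n) ≈ (suc n · 1#) * (x ^ n * δ x)
  δ-^ x zero = begin
    δ (x * 1#)                        ≈⟨ δ-cong (*-identityʳ x) ⟩
    δ x                               ≈⟨ solve 1 (λ a → a := (:1 :+ :0) :* (:1 :* a)) refl (δ x) ⟩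
    (1# + 0#) * (1# * δ x)            ∎
  δ-^ x (suc n) = begin
    δ (x * x ^ suc n)                                         ≈⟨ δ-* x _ ⟩
    δ x * x ^ suc n + x * δ (x ^ suc n)                       ≈⟨ +-congˡ (*-congˡ (δ-^ x n)) ⟩
    δ x * x ^ suc n + x * ((suc n · 1#) * (x ^ n * δ x))      ≈⟨ solve 4 (λ d x k y → d :* (x :* y) :+ x :* (k :* (y :* d)) := (:1 :+ k) :* ((x :* y) :* d)) refl (δ x) x (suc n · 1#) (x ^ n) ⟩
    (suc (suc n) · 1#) * (x ^ suc n * δ x)                    ∎

  δ-^-char : ∀ n → n · 1# ≈ 0# → ∀ x → δ (x ^ n) ≈ 0#
  δ-^-char zero _ x = δ-1
  δ-^-char (suc n) e x = trans (δ-^ x n) (trans (*-congʳ e) (zeroˡ _))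

  δ-^-constant : ∀ {x} n → δ x ≈ 0# → δ (x ^ n) ≈ 0#
  δ-^-constant zero _ = δ-1
  δ-^-constant {x} (suc n) e = begin
    δ (x * x ^ n)                  ≈⟨ δ-* x _ ⟩
    δ x * x ^ n + x * δ (x ^ n)    ≈⟨ +-cong (*-congʳ e) (*-congˡ (δ-^-constant n e)) ⟩
    0# * x ^ n + x * 0#            ≈⟨ +-cong (zeroˡ _) (zeroʳ x) ⟩
    0# + 0#                        ≈⟨ +-identityˡ 0# ⟩
    0#                             ∎

  δ-*-constantˡ : ∀ {x} y → δ x ≈ 0# → δ (x * y) ≈ x * δ y
  δ-*-constantˡ {x} y e = trans (δ-* x y) (trans (+-congʳ (trans (*-congʳ e) (zeroˡ y))) (+-identityˡ _))

  -- Differentiating h m^2 leaves (h′ m + 2 h m′) m: a congruence modulo m^2 may be differentiated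
  -- to one modulo m.
  δ-∣ : ∀ {m x} → m ^ 2 ∣ x → m ∣ δ x
  δ-∣ {m} {x} (h ,ᵈ e) = δ h * m + (h * δ m + h * δ m) ,ᵈ (begin
    (δ h * m + (h * δ m + h * δ m)) * m           ≈⟨ solve 4 (λ h′ m h m′ →
                                                       (h′ :* m :+ (h :* m′ :+ h :* m′)) :* m :=
                                                       h′ :* (m :* m) :+ h :* (m′ :* m :+ m :* m′)) refl (δ h) m h (δ m) ⟩
    δ h * (m * m) + h * (δ m * m + m * δ m)       ≈⟨ +-congˡ (*-congˡ (δ-* m m)) ⟨
    δ h * (m * m) + h * δ (m * m)                 ≈⟨ δ-* h (m * m) ⟨
    δ (h * (m * m))                               ≈⟨ δ-cong (trans (*-congˡ (*-congˡ (sym (*-identityʳ m)))) e) ⟩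
    δ x                                           ∎)

-- The sequences L and D, and their congruences modulo a prime.

module Carlitz {c ℓ} (R : CommutativeRing c ℓ) (q : ℕ) (1<q : 1 ℕ.< q)
  (frobenius : AdditivePowers.Additive R q) (T : CommutativeRing.Carrier R) where
  open CommutativeRing R
  open Divides R
  open MonicPolynomials R
  open IntegerSolver R
  open AdditivePowers R
  open import Algebra.Definitions.RawMonoid +-rawMonoid using () renaming (_×_ to _·_)
  open import Relation.Binary.Reasoning.Setoid setoid

  θ : ℕ → Carrier
  θ n = T ^ (q ℕ.^ n)

  bracket : ℕ → Carrier
  bracket n = θ n - T

  L : ℕ → Carrier
  L zero = 1#
  L (suc n) = bracket (suc n) * L n

  D : ℕ → Carrier
  D zero = 1#
  D (suc n) = bracket (suc n) * D n ^ q

  θ-^ : ∀ k i → θ k ^ (q ℕ.^ i) ≈ θ (k ℕ.+ i)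
  θ-^ k i = trans (^-assocʳ T (q ℕ.^ k) (q ℕ.^ i)) (^-congʳ T (≡.sym (ℕₚ.^-distribˡ-+-* q k i)))

  bracket-^ : ∀ k i → bracket k ^ (q ℕ.^ i) ≈ θ (k ℕ.+ i) - θ i
  bracket-^ k i = trans (additive-sub (q ℕ.^ i) (additive-^ q i frobenius) _ _) (+-congʳ (θ-^ k i))

  L-prod : ∀ n → L n ≈ prod (λ i → bracket (suc i)) n
  L-prod zero = refl
  L-prod (suc n) = trans (*-congˡ (L-prod n)) (sym (prod-last (λ i → bracket (suc i)) n))

  -- The q-th power shifts both indices of θ_n - θ_i by one, and the factor [n+1] supplies the
  -- missing index i = 0.
  D-prod : ∀ n → D n ≈ prod (λ i → θ n - θ i) n
  D-prod zero = refl
  D-prod (suc n) = *-cong (+-congˡ (-‿cong (sym (x^1≈x T)))) (begin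
    D n ^ q                                       ≈⟨ ^-congˡ q (D-prod n) ⟩
    prod (λ i → θ n - θ i) n ^ q                  ≈⟨ prod-^ (λ i → θ n - θ i) n q ⟩
    prod (λ i → (θ n - θ i) ^ q) n                ≈⟨ prod-cong n (λ i → trans (additive-sub q frobenius _ _) (+-cong (step n) (-‿cong (step i)))) ⟩
    prod (λ i → θ (suc n) - θ (suc i)) n          ∎)
    where
    step : ∀ k → θ k ^ q ≈ θ (suc k)
    step k = trans (^-assocʳ T (q ℕ.^ k) q) (^-congʳ T (ℕₚ.*-comm (q ℕ.^ k) q))

  1≤q^ : ∀ n → 1 ℕ.≤ q ℕ.^ n
  1≤q^ n = ℕₚ.m^n>0 q {{ℕ.>-nonZero (ℕₚ.<-trans (s≤s z≤n) 1<q)}} n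

  q≤q^1+ : ∀ n → q ℕ.≤ q ℕ.^ suc n
  q≤q^1+ n = ≡.subst (ℕ._≤ q ℕ.^ suc n) (ℕₚ.*-identityʳ q) (ℕₚ.*-monoʳ-≤ q (1≤q^ n))

  -- All that is asked of A: `n` + 1 is the degree d, `l` lists the coefficients of ℘(X) below the
  -- leading one, and `residues` consists of q^d elements that stay distinct modulo ℘.
  module PrimeModulus
    (℘ : Carrier) (n : ℕ) (l : Vec Carrier (suc n))
    (fixed : VecAll.All (λ a → a ^ q ≈ a) l) (℘≈ : ℘ ≈ eval l T)
    (℘∤1 : ¬ ℘ ∣ 1#) (∣-or-coprime : ∀ x → ℘ ∣ x ⊎ Coprime ℘ x)
    (residues : List Carrier) (residues-separated : Separated ℘ residues)
    (residues-length : length residues ≡ q ℕ.^ suc n)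
    (residues-fixed : ∀ m → ℘ ∣ bracket m → All (λ r → ℘ ∣ r ^ (q ℕ.^ m) - r) residues)
    where

    s : ℕ → Carrier
    s k = (- 1#) ^ k

    -- Otherwise x, and with it x^k, would be invertible modulo ℘.
    prime-^ : ∀ {x} k → ℘ ∣ x ^ k → ℘ ∣ x
    prime-^ {x} k e with ∣-or-coprime x
    ... | inj₁ d = d
    ... | inj₂ κ = ⊥-elim (℘∤1 (coprime∣⇒∣1 (coprime-^ʳ k κ) e))

    coprime-s : ∀ k → Coprime ℘ (s k)
    coprime-s k = coprime-^ʳ k (- 1# , ∣-resp (solve 0 (:0 := :- :1 :* :- :1 :- :1) refl) ∣0)

    -- If ℘ divided [m], raising to the power q^m would fix all q^(n+1) residues.
    ∤-bracket : ∀ m → 1 ℕ.≤ m → m ℕ.≤ n → ¬ ℘ ∣ bracket m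
    ∤-bracket m@(suc m-1) _ m≤n d = go _ ≡.refl (ℕₚ.≤-trans 1<q (q≤q^1+ m-1))
      where
      go : ∀ N → q ℕ.^ m ≡ N → 1 ℕ.< N → ⊥
      go (suc (suc k)) eq _ = ℕₚ.<⇒≱ (ℕₚ.^-monoʳ-< q 1<q (s≤s m≤n))
        (≡.subst₂ ℕ._≤_ residues-length (≡.sym eq)
          (root-bound residues (X^ k -X) ℘∤1 residues-separated
            (All.map (λ {r} → ∣-resp (trans (+-congʳ (^-congʳ r eq)) (sym (eval-X^n-X k r)))) (residues-fixed m d))))
      go (suc zero) _ (s≤s ())

    coprime-bracket : ∀ m → 1 ℕ.≤ m → m ℕ.≤ n → Coprime ℘ (bracket m)
    coprime-bracket m 1≤m m≤n = [ (λ d → ⊥-elim (∤-bracket m 1≤m m≤n d)) , (λ κ → κ) ]′ (∣-or-coprime (bracket m))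

    coprime-L : ∀ k → k ℕ.≤ n → Coprime ℘ (L k)
    coprime-L zero _ = coprime-^ʳ {z = 1#} 0 (coprime-s 0)
    coprime-L (suc k) k<n = coprime-*ʳ (coprime-bracket (suc k) (s≤s z≤n) k<n) (coprime-L k (ℕₚ.<⇒≤ k<n))

    θs : List Carrier
    θs = applyUpTo (λ i → θ (suc i)) (suc n)

    -- For i < j the difference θ_j - θ_i is the q^i-th power of [j - i], and 0 < j - i ≤ n for the
    -- indices in the list. Invertibility modulo ℘ then passes to ℘^q.
    θs-separated : Separated (℘ ^ q) θs
    θs-separated = AllPairsₚ.applyUpTo⁺₁ (λ i → θ (suc i)) (suc n) λ {i} {j} i<j j≤n →
      coprime-^ˡ q (coprime-resp
        (trans (bracket-^ (j ℕ.∸ i) (suc i)) (+-congʳ (reflexive (≡.cong θ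
          (≡.trans (ℕₚ.+-suc (j ℕ.∸ i) i) (≡.cong suc (ℕₚ.m∸n+n≡m (ℕₚ.<⇒≤ i<j))))))))
        (coprime-^ʳ (q ℕ.^ suc i) (coprime-bracket (j ℕ.∸ i) (ℕₚ.m<n⇒0<n∸m i<j)
          (ℕₚ.≤-trans (ℕₚ.m∸n≤m j i) (ℕₚ.≤-pred j≤n)))))

    -- The list starts at T^q and not at T: ℘(T^N) = ℘^N, and N ≥ q is what raises the modulus from
    -- ℘ to ℘^q.
    θs-roots : All (λ x → ℘ ^ q ∣ eval l x) θs
    θs-roots = Allₚ.applyUpTo⁺₂ (λ i → θ (suc i)) (suc n) λ i → ∣-resp
      (sym (trans (eval-^ (q ℕ.^ suc i) (additive-^ q (suc i) frobenius) (VecAll.map (fixed-^ q (suc i)) fixed) T)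
                  (^-congˡ (q ℕ.^ suc i) (sym ℘≈))))
      (^-∣ ℘ (q≤q^1+ i))

    -- The T^(q^i), 1 ≤ i ≤ n + 1, are separated roots of ℘(X) modulo ℘^q, hence
    -- ℘(X) ≡ ∏ (X - T^(q^i)) modulo ℘^q; now put X = T.
    ℘≡L : ℘ ^ q ∣ ℘ - s (suc n) * (bracket (suc n) * L n)
    ℘≡L = ∣-resp (+-cong (sym ℘≈) (-‿cong (begin
      linearProduct θs T                            ≈⟨ linearProduct-applyUpTo (λ i → θ (suc i)) (suc n) T ⟩
      prod (λ i → T - θ (suc i)) (suc n)            ≈⟨ prod-cong (suc n) (λ i → solve 2 (λ x y → x :- y := :- (y :- x)) refl T (θ (suc i))) ⟩
      prod (λ i → - bracket (suc i)) (suc n)        ≈⟨ prod-neg (λ i → bracket (suc i)) (suc n) ⟩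
      s (suc n) * prod (λ i → bracket (suc i)) (suc n) ≈⟨ *-congˡ (L-prod (suc n)) ⟨
      s (suc n) * L (suc n)                         ∎)))
      (factorisation θs l (Listₚ.length-applyUpTo (λ i → θ (suc i)) (suc n)) θs-separated θs-roots T)

    ℘∣℘^q : ℘ ∣ ℘ ^ q
    ℘∣℘^q = ∣-x^ ℘ q (ℕₚ.<⇒≤ 1<q) ∣-refl

    -- Instead of an appeal to Fermat's theorem in A/℘, the key congruence is read modulo ℘, where
    -- the sign and L_n are units.
    ℘∣bracket : ℘ ∣ bracket (suc n)
    ℘∣bracket = coprime-cancel _ (coprime-L n ℕₚ.≤-refl) (∣-resp (*-comm _ _)
      (coprime-cancel _ (coprime-s (suc n)) (∣-resp
        (solve 2 (λ a b → a :- (a :- b) := b) refl ℘ _)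
        (∣-sub ∣-refl (∣-trans ℘∣℘^q ℘≡L)))))

    -- [i+1]^(q^n) = T^(q^(n+1+i)) - T^(q^n) ≡ - (T^(q^n) - T^(q^i)) since T^(q^(n+1)) ≡ T.
    D≡L : ℘ ∣ D n - s n * L n ^ (q ℕ.^ n)
    D≡L = ∣-resp (+-cong (sym (D-prod n)) (-‿cong (begin
      prod (λ i → - (bracket (suc i) ^ (q ℕ.^ n))) n      ≈⟨ prod-neg (λ i → bracket (suc i) ^ (q ℕ.^ n)) n ⟩
      s n * prod (λ i → bracket (suc i) ^ (q ℕ.^ n)) n    ≈⟨ *-congˡ (prod-^ (λ i → bracket (suc i)) n (q ℕ.^ n)) ⟨
      s n * prod (λ i → bracket (suc i)) n ^ (q ℕ.^ n)    ≈⟨ *-congˡ (^-congˡ (q ℕ.^ n) (L-prod n)) ⟨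
      s n * L n ^ (q ℕ.^ n)                               ∎)))
      (prod-≡ n λ i → ∣-resp
        (trans (trans (bracket-^ (suc n) i) (+-congʳ (reflexive (≡.cong (λ k → θ (suc k)) (ℕₚ.+-comm n i)))))
          (trans (solve 3 (λ a b c → a :- b := (c :- b) :- :- (a :- c)) refl (θ (suc i ℕ.+ n)) (θ i) (θ n))
            (+-congˡ (-‿cong (-‿cong (sym (bracket-^ (suc i) n)))))))
        (∣-x^ _ (q ℕ.^ i) (1≤q^ i) ℘∣bracket))

    module Derived (δ : Carrier → Carrier) (isDerivation : IsDerivation R δ) (δT : δ T ≈ 1#)
      (q·1≈0 : q · 1# ≈ 0#) where
      open Derivation isDerivation

      -- T^(q^(k+1)) is a q-th power, so only - T contributes.
      δ-bracket : ∀ k → δ (bracket (suc k)) ≈ - 1#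
      δ-bracket k = begin
        δ (θ (suc k) - T)                   ≈⟨ δ-sub _ T ⟩
        δ (θ (suc k)) - δ T                 ≈⟨ +-cong (δ-cong (trans (sym (^-assocʳ T q (q ℕ.^ k))) (^-^-comm T q (q ℕ.^ k)))) (-‿cong δT) ⟩
        δ ((T ^ (q ℕ.^ k)) ^ q) - 1#        ≈⟨ +-congʳ (δ-^-char q q·1≈0 _) ⟩
        0# - 1#                             ≈⟨ +-identityˡ _ ⟩
        - 1#                                ∎

      δ-s : ∀ k → δ (s k) ≈ 0#
      δ-s k = δ-^-constant k (trans (δ-neg 1#) (trans (-‿cong δ-1) (solve 0 (:- :0 := :0) refl)))

      δ℘≡L : ℘ ∣ δ ℘ - s n * L n
      δ℘≡L = ∣-resp
        (trans (+-congʳ (begin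
          δ (℘ - s (suc n) * (bracket (suc n) * L n))
            ≈⟨ trans (δ-sub _ _) (+-congˡ (-‿cong (δ-*-constantˡ _ (δ-s (suc n))))) ⟩
          δ ℘ - s (suc n) * δ (bracket (suc n) * L n)
            ≈⟨ +-congˡ (-‿cong (*-congˡ (trans (δ-* _ _) (+-congʳ (*-congʳ (δ-bracket n)))))) ⟩
          δ ℘ - s (suc n) * (- 1# * L n + bracket (suc n) * δ (L n)) ∎))
        (solve 5 (λ ℘′ s L b L′ →
          ℘′ :- (:- :1 :* s) :* (:- :1 :* L :+ b :* L′) :+ b :* ((:- :1 :* s) :* L′) := ℘′ :- s :* L)
          refl (δ ℘) (s n) (L n) (bracket (suc n)) (δ (L n))))
        -- Differentiation modulo ℘ needs the key congruence only modulo ℘^2, and 2 ≤ q. The term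
        -- with `δ (L n)` carries the factor [n+1], a multiple of ℘.
        (∣-+ (δ-∣ (∣-trans (^-∣ ℘ 1<q) ℘≡L)) (∣-*ʳ _ ℘∣bracket))

      -- Here `e` plays the part of c. The signed constant (-1)^n c, called e in the overview, is
      -- `s n * e`.
      module Translated (e : Carrier) (e^q≈e : e ^ q ≈ e) (℘∤e : ¬ ℘ ∣ e) (δe≈0 : δ e ≈ 0#) where

        e^q^k≈e : ∀ k → e ^ (q ℕ.^ k) ≈ e
        e^q^k≈e k = fixed-^ q k e^q≈e

        private
          L^≡e : ∀ k → ℘ ∣ L n - e → ℘ ∣ L n ^ (q ℕ.^ k) - e
          L^≡e k d = ∣-resp (+-congˡ (-‿cong (e^q^k≈e k))) (∣-^-sub (q ℕ.^ k) d)

        -- Both directions go through L_n^(q^n) - e, which is the q^n-th power of L_n - e because e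
        -- is fixed. Since ℘ is prime, it divides the power only if it divides the base.
        L≡e⇔D≡e : ℘ ∣ L n - e ⇔ ℘ ∣ D n + s (suc n) * e
        L≡e⇔D≡e = mk⇔
          (λ d → ∣-resp
            (solve 4 (λ D s L e → (D :- s :* L) :+ s :* (L :- e) := D :+ (:- :1 :* s) :* e) refl (D n) (s n) (L n ^ (q ℕ.^ n)) e)
            (∣-+ D≡L (∣-*ˡ (s n) (L^≡e n d))))
          (λ d → prime-^ (q ℕ.^ n) (∣-resp
            (trans (+-congˡ (-‿cong (sym (e^q^k≈e n)))) (sym (additive-sub (q ℕ.^ n) (additive-^ q n frobenius) (L n) e)))
            (coprime-cancel _ (coprime-s n) (∣-resp
              (solve 4 (λ D s L e → (D :+ (:- :1 :* s) :* e) :- (D :- s :* L) := s :* (L :- e)) refl (D n) (s n) (L n ^ (q ℕ.^ n)) e)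
              (∣-sub d D≡L)))))

        L≡e⇔δ℘≡e : ℘ ∣ L n - e ⇔ ℘ ∣ δ ℘ - s n * e
        L≡e⇔δ℘≡e = mk⇔
          (λ d → ∣-resp
            (solve 4 (λ ℘′ s L e → (℘′ :- s :* L) :+ s :* (L :- e) := ℘′ :- s :* e) refl (δ ℘) (s n) (L n) e)
            (∣-+ δ℘≡L (∣-*ˡ (s n) d)))
          (λ d → coprime-cancel _ (coprime-s n) (∣-resp
            (solve 4 (λ ℘′ s L e → (℘′ :- s :* e) :- (℘′ :- s :* L) := s :* (L :- e)) refl (δ ℘) (s n) (L n) e)
            (∣-sub d δ℘≡L)))

        -- If ℘^2 divided this, ℘ would divide the derivative - D_(n-1)^q, hence also D_n = [n]
        -- D_(n-1)^q, and so e itself. The auxiliary `go` frees the index of D so that D can be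
        -- unfolded, while the sign keeps n.
        D-multiplicity : 1 ℕ.≤ n → ¬ ℘ ^ 2 ∣ D n + s (suc n) * e
        D-multiplicity = go n
          where
          go : ∀ k → 1 ℕ.≤ k → ¬ ℘ ^ 2 ∣ D k + s (suc n) * e
          go (suc k) _ d = ℘∤e (coprime-cancel e (coprime-s (suc n)) (∣-resp
            (solve 2 (λ a b → (a :+ b) :- a := b) refl (D (suc k)) _)
            (∣-sub (∣-trans (∣-x^ ℘ 2 (s≤s z≤n) ∣-refl) d) (∣-*ˡ (bracket (suc k)) ℘∣D^q))))
            where
            δD : δ (D (suc k) + s (suc n) * e) ≈ - (D k ^ q)
            δD = begin
              δ (bracket (suc k) * D k ^ q + s (suc n) * e)
                ≈⟨ δ-+ _ _ ⟩
              δ (bracket (suc k) * D k ^ q) + δ (s (suc n) * e)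
                ≈⟨ +-cong (δ-* _ _) (trans (δ-*-constantˡ e (δ-s (suc n))) (trans (*-congˡ δe≈0) (zeroʳ _))) ⟩
              δ (bracket (suc k)) * D k ^ q + bracket (suc k) * δ (D k ^ q) + 0#
                ≈⟨ +-congʳ (+-cong (*-congʳ (δ-bracket k)) (trans (*-congˡ (δ-^-char q q·1≈0 (D k))) (zeroʳ _))) ⟩
              - 1# * D k ^ q + 0# + 0#
                ≈⟨ trans (+-identityʳ _) (trans (+-identityʳ _) (solve 1 (λ x → :- :1 :* x := :- x) refl (D k ^ q))) ⟩
              - (D k ^ q) ∎
            ℘∣D^q : ℘ ∣ D k ^ q
            ℘∣D^q = ∣-resp (solve 1 (λ x → :- :- x := x) refl _) (∣-neg (∣-resp δD (δ-∣ d)))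

        -- Comparing ℘^(q^(n+1)) with ℘ = a^p + (-1)^n e T gives ℘ ≡ - (-1)^n e [n+1] modulo ℘^p.
        -- Together with ℘≡L this yields [n+1] (L n - e) ≡ 0, and [n+1] has ℘-adic valuation one.
        L-multiplicity : ∀ {p-1} a → (∀ x → ℘ * x ≈ 0# → x ≈ 0#) → Additive (suc p-1) → suc p-1 ℕ.≤ q →
                         ℘ ≈ a ^ suc p-1 + (s n * e) * T → ℘ ^ p-1 ∣ L n - e
        L-multiplicity {p-1} a regular add p≤q ℘≈a = coprime-cancel _ (coprime-^ˡ p-1 (coprime-s n))
          (coprime-cancel _ (coprime-^ˡ p-1 coprime-w) ∣w*)
          where
          p Q : ℕ
          p = suc p-1
          Q = q ℕ.^ suc n
          f z b w : Carrier
          f = s n * e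
          z = a ^ Q - a
          b = bracket (suc n)
          w = _∣ʳ_.quotient ℘∣bracket

          w*℘≈b : w * ℘ ≈ b
          w*℘≈b = _∣ʳ_.equality ℘∣bracket

          f^Q≈f : f ^ Q ≈ f
          f^Q≈f = trans (^-distrib-* (s n) e Q) (*-cong (trans (^-^-comm (- 1#) n Q) (^-congˡ n -1^Q)) (e^q^k≈e (suc n)))
            where
            -- Additivity applied to 0 - 1 settles the sign whether Q is even or odd; for even Q it
            -- forces - 1 = 1.
            -1^Q : (- 1#) ^ Q ≈ - 1#
            -1^Q = begin
              (- 1#) ^ Q          ≈⟨ ^-congˡ Q (solve 0 (:- :1 := :0 :- :1) refl) ⟩
              (0# - 1#) ^ Q       ≈⟨ additive-sub Q (additive-^ q (suc n) frobenius) 0# 1# ⟩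
              0# ^ Q - 1# ^ Q     ≈⟨ +-cong (0^ Q (1≤q^ (suc n))) (-‿cong (1^n≈1 Q)) ⟩
              0# - 1#             ≈⟨ +-identityˡ _ ⟩
              - 1#                ∎
              where
              0^ : ∀ k → 1 ℕ.≤ k → 0# ^ k ≈ 0#
              0^ (suc k) _ = zeroˡ _

          frobenius-difference : ℘ ^ Q - ℘ ≈ z ^ p + f * b
          frobenius-difference = begin
            ℘ ^ Q - ℘
              ≈⟨ +-cong (^-congˡ Q ℘≈a) (-‿cong ℘≈a) ⟩
            (a ^ p + f * T) ^ Q - (a ^ p + f * T)
              ≈⟨ +-congʳ (additive-^ q (suc n) frobenius _ _) ⟩
            (a ^ p) ^ Q + (f * T) ^ Q - (a ^ p + f * T)
              ≈⟨ +-congʳ (+-cong (^-^-comm a p Q) (trans (^-distrib-* f T Q) (*-congʳ f^Q≈f))) ⟩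
            (a ^ Q) ^ p + f * T ^ Q - (a ^ p + f * T)
              ≈⟨ solve 5 (λ x y f u v → x :+ f :* u :- (y :+ f :* v) := (x :- y) :+ f :* (u :- v)) refl ((a ^ Q) ^ p) (a ^ p) f (T ^ Q) T ⟩
            ((a ^ Q) ^ p - a ^ p) + f * b
              ≈⟨ +-congʳ (additive-sub p add (a ^ Q) a) ⟨
            z ^ p + f * b ∎

          p≤Q : p ℕ.≤ Q
          p≤Q = ℕₚ.≤-trans p≤q (q≤q^1+ n)

          ℘∣z : ℘ ∣ z
          ℘∣z = prime-^ p (∣-resp
            (trans (+-congʳ frobenius-difference) (solve 2 (λ x y → x :+ y :- y := x) refl (z ^ p) (f * b)))
            (∣-sub (∣-sub (∣-x^ ℘ Q (1≤q^ (suc n)) ∣-refl) ∣-refl) (∣-*ˡ f ℘∣bracket)))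

          -- In ℘^Q - ℘ = z^p + f [n+1] both ℘^Q and z^p vanish modulo ℘^p, the first because p ≤ Q,
          -- the second because ℘ divides z.
          ℘≡b : ℘ ^ p ∣ ℘ + f * b
          ℘≡b = ∣-resp
            (begin
              ℘ ^ Q - z ^ p              ≈⟨ solve 3 (λ x y ℘ → x :- y := (x :- ℘) :+ ℘ :- y) refl (℘ ^ Q) (z ^ p) ℘ ⟩
              (℘ ^ Q - ℘) + ℘ - z ^ p    ≈⟨ +-congʳ (+-congʳ frobenius-difference) ⟩
              (z ^ p + f * b) + ℘ - z ^ p ≈⟨ solve 3 (λ y g ℘ → (y :+ g) :+ ℘ :- y := ℘ :+ g) refl (z ^ p) (f * b) ℘ ⟩
              ℘ + f * b                  ∎)
            (∣-sub (^-∣ ℘ p≤Q) (∣-^-mono p ℘∣z))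

          -- Differentiating w ℘ = [n+1] gives w′ ℘ + w ℘′ = -1, so - ℘′ inverts w modulo ℘. This is
          -- the valuation one of [n+1].
          coprime-w : Coprime ℘ w
          coprime-w = - δ ℘ , (δ w ,ᵈ (begin
            δ w * ℘                                 ≈⟨ solve 4 (λ w′ ℘ w ℘′ → w′ :* ℘ := (w′ :* ℘ :+ w :* ℘′) :+ w :* :- ℘′) refl (δ w) ℘ w (δ ℘) ⟩
            (δ w * ℘ + w * δ ℘) + w * - δ ℘         ≈⟨ +-congʳ (δ-* w ℘) ⟨
            δ (w * ℘) + w * - δ ℘                   ≈⟨ +-congʳ (trans (δ-cong w*℘≈b) (δ-bracket n)) ⟩
            - 1# + w * - δ ℘                        ≈⟨ +-comm _ _ ⟩
            w * - δ ℘ - 1#                          ∎))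

          -- Subtracting the two congruences modulo ℘^p leaves [n+1] (-1)^n (L_n - e), with [n+1] =
          -- w ℘. Cancelling ℘, which `regular` permits, costs one power.
          ∣w* : ℘ ^ p-1 ∣ w * (s n * (L n - e))
          ∣w* = k ,ᵈ (begin
            k * ℘ ^ p-1                                         ≈⟨ solve 2 (λ x y → x := (x :- y) :+ y) refl (k * ℘ ^ p-1) (w * (s n * (L n - e))) ⟩
            (k * ℘ ^ p-1 - w * (s n * (L n - e))) + w * (s n * (L n - e)) ≈⟨ +-congʳ (regular _ vanishes) ⟩
            0# + w * (s n * (L n - e))                          ≈⟨ +-identityˡ _ ⟩
            w * (s n * (L n - e))                               ∎)
            where
            ℘^p∣ : ℘ ^ p ∣ ℘ - s (suc n) * (b * L n) - (℘ + f * b)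
            ℘^p∣ = ∣-sub (∣-trans (^-∣ ℘ p≤q) ℘≡L) ℘≡b
            k : Carrier
            k = _∣ʳ_.quotient ℘^p∣
            vanishes : ℘ * (k * ℘ ^ p-1 - w * (s n * (L n - e))) ≈ 0#
            vanishes = begin
              ℘ * (k * ℘ ^ p-1 - w * (s n * (L n - e)))
                ≈⟨ solve 5 (λ ℘ k y w x → ℘ :* (k :* y :- w :* x) := k :* (℘ :* y) :- (w :* ℘) :* x)
                     refl ℘ k (℘ ^ p-1) w (s n * (L n - e)) ⟩
              k * ℘ ^ p - (w * ℘) * (s n * (L n - e))
                ≈⟨ +-cong (_∣ʳ_.equality ℘^p∣) (-‿cong (*-congʳ w*℘≈b)) ⟩
              (℘ - s (suc n) * (b * L n) - (℘ + f * b)) - b * (s n * (L n - e))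
                ≈⟨ solve 5 (λ ℘ s L b e → (℘ :- (:- :1 :* s) :* (b :* L) :- (℘ :+ (s :* e) :* b)) :- b :* (s :* (L :- e)) := :0)
                     refl ℘ (s n) (L n) b e ⟩
              0# ∎

-- Binomial coefficients and p-th powers in characteristic p.

-- Induction by Pascal's rule. The product form lets Euclid's lemma find a prime n + 1 in the
-- binomial coefficient without any factorials.
C-absorption : ∀ n k → suc k ℕ.* (suc n C suc k) ≡ suc n ℕ.* (n C k)
C-absorption zero zero = ≡.refl
C-absorption zero (suc k) = ≡.trans
  (≡.trans (≡.cong (suc (suc k) ℕ.*_) (k>n⇒nCk≡0 {1} {suc (suc k)} (s≤s (s≤s z≤n)))) (ℕₚ.*-zeroʳ (suc (suc k))))
  (≡.sym (≡.trans (ℕₚ.*-identityˡ _) (k>n⇒nCk≡0 {0} {suc k} (s≤s z≤n))))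
C-absorption (suc n) zero = ≡.trans (ℕₚ.*-identityˡ _)
  (≡.trans (nC1≡n (suc (suc n))) (≡.sym (ℕₚ.*-identityʳ (suc (suc n)))))
C-absorption (suc n) (suc k) = begin
  suc (suc k) ℕ.* (suc (suc n) C suc (suc k))
    ≡⟨ ≡.cong (suc (suc k) ℕ.*_) (nCk+nC[k+1]≡[n+1]C[k+1] (suc n) (suc k)) ⟨
  suc (suc k) ℕ.* (x ℕ.+ (suc n C suc (suc k)))
    ≡⟨ ℕₚ.*-distribˡ-+ (suc (suc k)) x _ ⟩
  (x ℕ.+ suc k ℕ.* x) ℕ.+ suc (suc k) ℕ.* (suc n C suc (suc k))
    ≡⟨ ≡.cong₂ (λ a b → (x ℕ.+ a) ℕ.+ b) (C-absorption n k) (C-absorption n (suc k)) ⟩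
  (x ℕ.+ suc n ℕ.* (n C k)) ℕ.+ suc n ℕ.* (n C suc k)
    ≡⟨ ℕₚ.+-assoc x _ _ ⟩
  x ℕ.+ (suc n ℕ.* (n C k) ℕ.+ suc n ℕ.* (n C suc k))
    ≡⟨ ≡.cong (x ℕ.+_) (ℕₚ.*-distribˡ-+ (suc n) (n C k) (n C suc k)) ⟨
  x ℕ.+ suc n ℕ.* ((n C k) ℕ.+ (n C suc k))
    ≡⟨ ≡.cong (λ a → x ℕ.+ suc n ℕ.* a) (nCk+nC[k+1]≡[n+1]C[k+1] n k) ⟩
  suc (suc n) ℕ.* x ∎
  where
  open ≡.≡-Reasoning
  x = suc n C suc k

-- The prime is `suc p`. By absorption it divides (k + 1) times the binomial coefficient, and it
-- exceeds k + 1.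
prime∣C : ∀ {p k} → Prime (suc p) → k ℕ.< p → suc p ∣ℕ (suc p C suc k)
prime∣C {p} {k} pr k<p with euclidsLemma (suc k) (suc p C suc k) pr
  (≡.subst (suc p ∣ℕ_) (≡.sym (C-absorption p k)) (ℕ∣.m∣m*n (p C k)))
... | inj₁ d = ⊥-elim (ℕₚ.<⇒≱ (s≤s k<p) (ℕ∣.∣⇒≤ d))
... | inj₂ d = d

module PrimeCharacteristic {c ℓ} (R : CommutativeRing c ℓ) where
  open CommutativeRing R
  open IntegerSolver R
  open AdditivePowers R
  open import Algebra.Definitions.RawMonoid +-rawMonoid using () renaming (_×_ to _·_)
  open import Algebra.Properties.Semiring.Mult semiring using (×-assoc-*; ×-congʳ; ×1-homo-*; ×-homo-1)
  open import Algebra.Properties.Semiring.Exp semiring using (_^_)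
  open import Algebra.Properties.Monoid.Sum +-monoid using (sum; sum-init-last; sum-cong-≋; sum-replicate-zero)
  open import Algebra.Properties.CommutativeSemiring.Binomial commutativeSemiring using (theorem; binomialTerm)
  open import Relation.Binary.Reasoning.Setoid setoid

  ∣⇒·≈0 : ∀ {p n} → p · 1# ≈ 0# → p ∣ℕ n → ∀ x → n · x ≈ 0#
  ∣⇒·≈0 {p} e (ℕ∣.divides k ≡.refl) x = begin
    (k ℕ.* p) · x                 ≈⟨ ×-congʳ (k ℕ.* p) (*-identityˡ x) ⟨
    (k ℕ.* p) · (1# * x)          ≈⟨ ×-assoc-* (k ℕ.* p) 1# x ⟨
    ((k ℕ.* p) · 1#) * x          ≈⟨ *-congʳ (×1-homo-* k p) ⟩
    (k · 1#) * (p · 1#) * x       ≈⟨ *-congʳ (trans (*-congˡ e) (zeroʳ _)) ⟩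
    0# * x                        ≈⟨ zeroˡ x ⟩
    0#                            ∎

  additive-prime : ∀ {p} → Prime p → p · 1# ≈ 0# → Additive p
  additive-prime {zero} pr = ⊥-elim (ℕₚ.n≮0 (ℕ.nonTrivial⇒n>1 0 {{prime⇒nonTrivial pr}}))
  additive-prime {suc p} pr e x y = begin
    (x + y) ^ suc p                                     ≈⟨ theorem (suc p) x y ⟩
    sum (binomialTerm x y (suc p))                      ≈⟨ +-cong first (sum-init-last (λ i → binomialTerm x y (suc p) (Fin.suc i))) ⟩
    y ^ suc p + (sum (λ i → binomialTerm x y (suc p) (Fin.suc (inject₁ i))) + binomialTerm x y (suc p) (Fin.suc (fromℕ p)))
                                                        ≈⟨ +-congˡ (+-cong (trans (sum-cong-≋ middle) (sum-replicate-zero p)) last) ⟩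
    y ^ suc p + (0# + x ^ suc p)                        ≈⟨ solve 2 (λ x y → y :+ (:0 :+ x) := x :+ y) refl (x ^ suc p) (y ^ suc p) ⟩
    x ^ suc p + y ^ suc p                               ∎
    where
    first : binomialTerm x y (suc p) Fin.zero ≈ y ^ suc p
    first = trans (×-homo-1 _) (*-identityˡ _)
    middle : ∀ (i : Fin p) → binomialTerm x y (suc p) (Fin.suc (inject₁ i)) ≈ 0#
    middle i = ∣⇒·≈0 e (prime∣C pr (≡.subst (ℕ._< p) (≡.sym (Finₚ.toℕ-inject₁ i)) (Finₚ.toℕ<n i))) _
    last : binomialTerm x y (suc p) (Fin.suc (fromℕ p)) ≈ x ^ suc p
    last rewrite Finₚ.toℕ-fromℕ p | nCn≡1 (suc p) | ℕₚ.n∸n≡0 p = trans (×-homo-1 _) (*-identityʳ _)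

-- Arithmetic of a finite field.

open ≡ using (refl; cong; cong₂; sym; trans; subst)

module ListFold {c ℓ} (M : CommutativeMonoid c ℓ) {A : Set} where
  open CommutativeMonoid M renaming (refl to ≈-refl; trans to ≈-trans; sym to ≈-sym)

  fold : (A → Carrier) → List A → Carrier
  fold g [] = ε
  fold g (x ∷ xs) = g x ∙ fold g xs

  fold-↭ : ∀ g {xs ys} → xs ↭ ys → fold g xs ≈ fold g ys
  fold-↭ g ↭.refl = ≈-refl
  fold-↭ g (↭.prep x p) = ∙-congˡ (fold-↭ g p)
  fold-↭ g (↭.swap x y p) = ≈-trans (∙-congˡ (∙-congˡ (fold-↭ g p)))
    (≈-trans (≈-sym (assoc _ _ _)) (≈-trans (∙-congʳ (comm _ _)) (assoc _ _ _)))
  fold-↭ g (↭.trans p q) = ≈-trans (fold-↭ g p) (fold-↭ g q)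

-- Used to reindex sums and products over F along a bijection.
unique-set⇒↭ : {A : Set} {xs ys : List A} → Unique xs → Unique ys →
               (∀ {x} → x ∈ xs → x ∈ ys) → (∀ {x} → x ∈ ys → x ∈ xs) → xs ↭ ys
unique-set⇒↭ u v f g = ∼bag⇒↭ (unique∧set⇒bag u v (mk⇔ f g))

module FiniteFieldProperties (F : FiniteField) where
  open FiniteField F

  field-ring : CommutativeRing 0ℓ 0ℓ
  field-ring = record { isCommutativeRing = isCommutativeRing }

  open CommutativeRing field-ring using (*-assoc; *-identityˡ; *-identityʳ; zeroˡ; zeroʳ;
    +-identityˡ; +-commutativeMonoid; *-commutativeMonoid; semiring; +-rawMonoid; _-_)
  open IntegerSolver field-ring
  open import Algebra.Properties.Semiring.Exp semiring using (_^_) public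
  open import Algebra.Properties.Semiring.Mult semiring using (×1-homo-*; ×-homo-+; ×-homo-1)
  open import Algebra.Definitions.RawMonoid +-rawMonoid using () renaming (_×_ to _·_) public
  open ≡.≡-Reasoning

  natC≡· : ∀ n → natC n ≡ n · 1#
  natC≡· zero = refl
  natC≡· (suc n) = cong (1# +_) (natC≡· n)

  natC-+ : ∀ m n → natC (m ℕ.+ n) ≡ natC m + natC n
  natC-+ m n rewrite natC≡· (m ℕ.+ n) | natC≡· m | natC≡· n = ×-homo-+ 1# m n

  natC-* : ∀ m n → natC (m ℕ.* n) ≡ natC m * natC n
  natC-* m n rewrite natC≡· (m ℕ.* n) | natC≡· m | natC≡· n = ×1-homo-* m n

  no-zero-divisors : ∀ {x y} → x * y ≡ 0# → x ≢ 0# → y ≡ 0#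
  no-zero-divisors {x} {y} e x≢0 with inverse x x≢0
  ... | x⁻¹ , xx⁻¹≡1 = begin
    y              ≡⟨ *-identityˡ y ⟨
    1# * y         ≡⟨ cong (_* y) xx⁻¹≡1 ⟨
    x * x⁻¹ * y    ≡⟨ solve 3 (λ x z y → x :* z :* y := z :* (x :* y)) refl x x⁻¹ y ⟩
    x⁻¹ * (x * y)  ≡⟨ cong (x⁻¹ *_) e ⟩
    x⁻¹ * 0#       ≡⟨ zeroʳ x⁻¹ ⟩
    0#             ∎

  *-cancelˡ : ∀ {a x y} → a ≢ 0# → a * x ≡ a * y → x ≡ y
  *-cancelˡ {a} {x} {y} a≢0 e = begin
    x              ≡⟨ solve 2 (λ x y → x := (x :- y) :+ y) refl x y ⟩
    (x - y) + y    ≡⟨ cong (_+ y) (no-zero-divisors (begin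
      a * (x - y)      ≡⟨ solve 3 (λ a x y → a :* (x :- y) := a :* x :- a :* y) refl a x y ⟩
      a * x - a * y    ≡⟨ cong (_- a * y) e ⟩
      a * y - a * y    ≡⟨ solve 1 (λ x → x :- x := :0) refl (a * y) ⟩
      0#               ∎) a≢0) ⟩
    0# + y         ≡⟨ +-identityˡ y ⟩
    y              ∎

  1+-↭ : map (1# +_) elements ↭ elements
  1+-↭ = unique-set⇒↭
    (Uniqueₚ.map⁺ (λ {x} {y} e → begin
      x                ≡⟨ solve 1 (λ x → x := :- :1 :+ (:1 :+ x)) refl x ⟩
      - 1# + (1# + x)  ≡⟨ cong (- 1# +_) e ⟩
      - 1# + (1# + y)  ≡⟨ solve 1 (λ x → :- :1 :+ (:1 :+ x) := x) refl y ⟩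
      y                ∎) unique)
    unique (λ _ → complete _)
    (λ {x} _ → subst (_∈ map (1# +_) elements) (solve 1 (λ x → :1 :+ (:- :1 :+ x) := x) refl x)
      (∈ₚ.∈-map⁺ (1# +_) (complete (- 1# + x))))

  -- The sum of all elements is unchanged by the substitution x ↦ 1 + x, which adds 1 to it once for
  -- each element.
  natC-card : natC card ≡ 0#
  natC-card = begin
    natC card                                        ≡⟨ solve 2 (λ x y → x := (x :+ y) :- y) refl (natC card) (fold id elements) ⟩
    (natC card + fold id elements) - fold id elements ≡⟨ cong (_- fold id elements) (fold-1+ elements) ⟨
    fold id (map (1# +_) elements) - fold id elements ≡⟨ cong (_- fold id elements) (fold-↭ id 1+-↭) ⟩
    fold id elements - fold id elements              ≡⟨ solve 1 (λ x → x :- x := :0) refl (fold id elements) ⟩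
    0#                                               ∎
    where
    open ListFold +-commutativeMonoid {Carrier}
    id : Carrier → Carrier
    id x = x
    fold-1+ : ∀ xs → fold id (map (1# +_) xs) ≡ natC (length xs) + fold id xs
    fold-1+ [] = sym (+-identityˡ 0#)
    fold-1+ (x ∷ xs) = begin
      1# + x + fold id (map (1# +_) xs)            ≡⟨ cong (1# + x +_) (fold-1+ xs) ⟩
      1# + x + (natC (length xs) + fold id xs)     ≡⟨ solve 3 (λ x n s → :1 :+ x :+ (n :+ s) := :1 :+ n :+ (x :+ s)) refl x (natC (length xs)) (fold id xs) ⟩
      1# + natC (length xs) + (x + fold id xs)     ∎

  -- Otherwise p and n are coprime, and a Bézout identity read in F gives 1 = 0.
  natC≡0⇒∣ : ∀ {p n} → Prime p → natC p ≡ 0# → natC n ≡ 0# → p ∣ℕ n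
  natC≡0⇒∣ {p} {n} pr p≡0 n≡0 with p ℕ∣.∣? n
  ... | yes d = d
  ... | no p∤n = ⊥-elim (1≢0 (bezout (Coprimality.coprime-Bézout coprime)))
    where
    coprime : Coprimality.Coprime p n
    coprime (d∣p , d∣n) with prime⇒irreducible pr d∣p
    ... | inj₁ d≡1 = d≡1
    ... | inj₂ refl = ⊥-elim (p∤n d∣n)
    one : ∀ {m k} x y → natC m ≡ 0# → natC k ≡ 0# → 1 ℕ.+ x ℕ.* m ≡ y ℕ.* k → 1# ≡ 0#
    one {m} {k} x y m≡0 k≡0 eq = begin
      1#                        ≡⟨ solve 1 (λ x → :1 := :1 :+ x :* :0) refl (natC x) ⟩
      1# + natC x * 0#          ≡⟨ cong (λ z → 1# + natC x * z) m≡0 ⟨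
      1# + natC x * natC m      ≡⟨ cong (1# +_) (natC-* x m) ⟨
      natC (1 ℕ.+ x ℕ.* m)      ≡⟨ cong natC eq ⟩
      natC (y ℕ.* k)            ≡⟨ natC-* y k ⟩
      natC y * natC k           ≡⟨ cong (natC y *_) k≡0 ⟩
      natC y * 0#               ≡⟨ zeroʳ _ ⟩
      0#                        ∎
    bezout : GCD.Bézout.Identity 1 p n → 1# ≡ 0#
    bezout (GCD.Bézout.+- x y eq) = one y x n≡0 p≡0 eq
    bezout (GCD.Bézout.-+ x y eq) = one x y p≡0 n≡0 eq

  private
    nonzero : List Carrier
    nonzero = filter (λ x → ¬? (x ≟ 0#)) elements

    nonzero-unique : Unique nonzero
    nonzero-unique = Uniqueₚ.filter⁺ (λ x → ¬? (x ≟ 0#)) unique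

    nonzero⁻ : ∀ {x} → x ∈ nonzero → x ≢ 0#
    nonzero⁻ x∈ = proj₂ (∈ₚ.∈-filter⁻ (λ x → ¬? (x ≟ 0#)) {xs = elements} x∈)

    nonzero⁺ : ∀ {x} → x ≢ 0# → x ∈ nonzero
    nonzero⁺ = ∈ₚ.∈-filter⁺ (λ x → ¬? (x ≟ 0#)) (complete _)

    elements↭0∷nonzero : elements ↭ 0# ∷ nonzero
    elements↭0∷nonzero = unique-set⇒↭ unique
      (All.tabulate (λ x∈ 0≡x → nonzero⁻ x∈ (sym 0≡x)) ∷ nonzero-unique)
      (λ {x} _ → split x) (λ _ → complete _)
      where
      split : ∀ x → x ∈ 0# ∷ nonzero
      split x with x ≟ 0#
      ... | yes refl = here refl
      ... | no x≢0 = there (nonzero⁺ x≢0)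

    *-↭ : ∀ {a} → a ≢ 0# → map (a *_) nonzero ↭ nonzero
    *-↭ {a} a≢0 with inverse a a≢0
    ... | a⁻¹ , aa⁻¹≡1 = unique-set⇒↭
      (Uniqueₚ.map⁺ (*-cancelˡ a≢0) nonzero-unique) nonzero-unique
      (λ x∈ → let (y , y∈ , x≡ay) = ∈ₚ.∈-map⁻ (a *_) x∈ in
        nonzero⁺ λ x≡0 → nonzero⁻ y∈ (no-zero-divisors (trans (sym x≡ay) x≡0) a≢0))
      (λ {x} x∈ → subst (_∈ map (a *_) nonzero) (aa⁻¹x≡x x)
        (∈ₚ.∈-map⁺ (a *_) (nonzero⁺ λ e → nonzero⁻ x∈ (trans (sym (aa⁻¹x≡x x)) (trans (cong (a *_) e) (zeroʳ a))))))
      where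
      aa⁻¹x≡x : ∀ x → a * (a⁻¹ * x) ≡ x
      aa⁻¹x≡x x = trans (sym (*-assoc a a⁻¹ x)) (trans (cong (_* x) aa⁻¹≡1) (*-identityˡ x))

  -- Multiplication by a ≠ 0 permutes the non-zero elements, so their product is unchanged while
  -- acquiring the factor a^(q-1). The remaining factor a comes from q = 1 + (q - 1) and takes care
  -- of a = 0.
  fermat : ∀ a → a ^ card ≡ a
  fermat a = trans (cong (a ^_) (↭-length elements↭0∷nonzero)) (go a)
    where
    open ListFold *-commutativeMonoid {Carrier}
    id : Carrier → Carrier
    id x = x
    fold-* : ∀ a xs → fold id (map (a *_) xs) ≡ fold id xs * a ^ length xs
    fold-* a [] = sym (*-identityˡ 1#)
    fold-* a (x ∷ xs) = begin
      a * x * fold id (map (a *_) xs)         ≡⟨ cong (a * x *_) (fold-* a xs) ⟩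
      a * x * (fold id xs * a ^ length xs)    ≡⟨ solve 4 (λ a x f n → a :* x :* (f :* n) := x :* f :* (a :* n)) refl a x (fold id xs) (a ^ length xs) ⟩
      x * fold id xs * (a * a ^ length xs)    ∎
    fold≢0 : ∀ {xs} → All (_≢ 0#) xs → fold id xs ≢ 0#
    fold≢0 [] = 1≢0
    fold≢0 (x≢0 ∷ ps) e = fold≢0 ps (no-zero-divisors e x≢0)
    go : ∀ a → a * a ^ length nonzero ≡ a
    go a with a ≟ 0#
    ... | yes refl = zeroˡ _
    ... | no a≢0 = trans (cong (a *_) (*-cancelˡ (fold≢0 (All.tabulate nonzero⁻))
      (trans (sym (fold-* a nonzero)) (trans (fold-↭ id (*-↭ a≢0)) (sym (*-identityʳ _)))))) (*-identityʳ a)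

  1≤card : 1 ℕ.≤ card
  1≤card = subst (1 ℕ.≤_) (sym (↭-length elements↭0∷nonzero)) (s≤s z≤n)

-- The polynomial ring A and its derivation.

module PolynomialRing (F : FiniteField) where
  open FiniteField F
  open Poly F
  open FiniteFieldProperties F
  private module K = CommutativeRing field-ring
  open IntegerSolver field-ring

  -- ≈ₚ unfolds to a function type, from which Agda cannot infer the polynomials; hence the wrapper.
  infix 4 _≋_
  record _≋_ (f g : P) : Set where
    constructor pointwise
    field coeffs : f ≈ₚ g
  open _≋_ public

  coeff-+ : ∀ f g i → coeff (f +ₚ g) i ≡ coeff f i + coeff g i
  coeff-+ [] g i = sym (K.+-identityˡ _)
  coeff-+ (a ∷ f) [] i = sym (K.+-identityʳ _)
  coeff-+ (a ∷ f) (b ∷ g) zero = refl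
  coeff-+ (a ∷ f) (b ∷ g) (suc i) = coeff-+ f g i

  coeff-scale : ∀ c f i → coeff (scale c f) i ≡ c * coeff f i
  coeff-scale c [] i = sym (K.zeroʳ c)
  coeff-scale c (a ∷ f) zero = refl
  coeff-scale c (a ∷ f) (suc i) = coeff-scale c f i

  coeff-neg : ∀ f i → coeff (-ₚ f) i ≡ - coeff f i
  coeff-neg [] i = solve 0 (:0 := :- :0) refl
  coeff-neg (a ∷ f) zero = refl
  coeff-neg (a ∷ f) (suc i) = coeff-neg f i

  ≋-refl : ∀ {f} → f ≋ f
  ≋-refl = pointwise λ _ → refl

  ≋-sym : ∀ {f g} → f ≋ g → g ≋ f
  ≋-sym e = pointwise λ i → sym (coeffs e i)

  ≋-trans : ∀ {f g h} → f ≋ g → g ≋ h → f ≋ h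
  ≋-trans e e′ = pointwise λ i → trans (coeffs e i) (coeffs e′ i)

  ∷-cong : ∀ {a b f g} → a ≡ b → f ≋ g → a ∷ f ≋ b ∷ g
  ∷-cong a≡b e = pointwise λ { zero → a≡b ; (suc i) → coeffs e i }

  0∷[]≋[] : 0# ∷ [] ≋ []
  0∷[]≋[] = pointwise λ { zero → refl ; (suc i) → refl }

  +ₚ-cong : ∀ {f f′ g g′} → f ≋ f′ → g ≋ g′ → f +ₚ g ≋ f′ +ₚ g′
  +ₚ-cong {f} {f′} {g} {g′} e e′ = pointwise λ i →
    trans (coeff-+ f g i) (trans (cong₂ _+_ (coeffs e i) (coeffs e′ i)) (sym (coeff-+ f′ g′ i)))

  -ₚ-cong : ∀ {f g} → f ≋ g → -ₚ f ≋ -ₚ g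
  -ₚ-cong {f} {g} e = pointwise λ i → trans (coeff-neg f i) (trans (cong -_ (coeffs e i)) (sym (coeff-neg g i)))

  scale-cong : ∀ c {f g} → f ≋ g → scale c f ≋ scale c g
  scale-cong c {f} {g} e = pointwise λ i → trans (coeff-scale c f i) (trans (cong (c *_) (coeffs e i)) (sym (coeff-scale c g i)))

  +ₚ-assoc : ∀ f g h → (f +ₚ g) +ₚ h ≋ f +ₚ (g +ₚ h)
  +ₚ-assoc f g h = pointwise λ i → begin
    coeff ((f +ₚ g) +ₚ h) i                ≡⟨ coeff-+ (f +ₚ g) h i ⟩
    coeff (f +ₚ g) i + coeff h i           ≡⟨ cong (_+ coeff h i) (coeff-+ f g i) ⟩
    coeff f i + coeff g i + coeff h i      ≡⟨ K.+-assoc _ _ _ ⟩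
    coeff f i + (coeff g i + coeff h i)    ≡⟨ cong (coeff f i +_) (coeff-+ g h i) ⟨
    coeff f i + coeff (g +ₚ h) i           ≡⟨ coeff-+ f (g +ₚ h) i ⟨
    coeff (f +ₚ (g +ₚ h)) i                ∎
    where open ≡.≡-Reasoning

  +ₚ-comm : ∀ f g → f +ₚ g ≋ g +ₚ f
  +ₚ-comm f g = pointwise λ i → trans (coeff-+ f g i) (trans (K.+-comm _ _) (sym (coeff-+ g f i)))

  +ₚ-identityʳ : ∀ f → f +ₚ [] ≋ f
  +ₚ-identityʳ f = +ₚ-comm f []

  +ₚ-inverseʳ : ∀ f → f +ₚ (-ₚ f) ≋ []
  +ₚ-inverseʳ f = pointwise λ i → trans (coeff-+ f (-ₚ f) i) (trans (cong (coeff f i +_) (coeff-neg f i)) (K.-‿inverseʳ _))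

  scale-distribˡ : ∀ c f g → scale c (f +ₚ g) ≋ scale c f +ₚ scale c g
  scale-distribˡ c f g = pointwise λ i → begin
    coeff (scale c (f +ₚ g)) i                ≡⟨ coeff-scale c (f +ₚ g) i ⟩
    c * coeff (f +ₚ g) i                      ≡⟨ cong (c *_) (coeff-+ f g i) ⟩
    c * (coeff f i + coeff g i)               ≡⟨ K.distribˡ c _ _ ⟩
    c * coeff f i + c * coeff g i             ≡⟨ cong₂ _+_ (coeff-scale c f i) (coeff-scale c g i) ⟨
    coeff (scale c f) i + coeff (scale c g) i ≡⟨ coeff-+ (scale c f) (scale c g) i ⟨
    coeff (scale c f +ₚ scale c g) i          ∎
    where open ≡.≡-Reasoning

  scale-distribʳ : ∀ a b f → scale (a + b) f ≋ scale a f +ₚ scale b f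
  scale-distribʳ a b f = pointwise λ i → begin
    coeff (scale (a + b) f) i                 ≡⟨ coeff-scale (a + b) f i ⟩
    (a + b) * coeff f i                       ≡⟨ K.distribʳ _ a b ⟩
    a * coeff f i + b * coeff f i             ≡⟨ cong₂ _+_ (coeff-scale a f i) (coeff-scale b f i) ⟨
    coeff (scale a f) i + coeff (scale b f) i ≡⟨ coeff-+ (scale a f) (scale b f) i ⟨
    coeff (scale a f +ₚ scale b f) i          ∎
    where open ≡.≡-Reasoning

  scale-* : ∀ a b f → scale (a * b) f ≋ scale a (scale b f)
  scale-* a b f = pointwise λ i → trans (coeff-scale (a * b) f i) (trans (K.*-assoc a b _)
    (sym (trans (coeff-scale a (scale b f) i) (cong (a *_) (coeff-scale b f i)))))

  scale-0 : ∀ f → scale 0# f ≋ []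
  scale-0 f = pointwise λ i → trans (coeff-scale 0# f i) (K.zeroˡ _)

  scale-1 : ∀ f → scale 1# f ≋ f
  scale-1 f = pointwise λ i → trans (coeff-scale 1# f i) (K.*-identityˡ _)

  private
    +-monoid : CommutativeMonoid 0ℓ 0ℓ
    +-monoid = record
      { Carrier = P ; _≈_ = _≋_ ; _∙_ = _+ₚ_ ; ε = []
      ; isCommutativeMonoid = record
        { isMonoid = record
          { isSemigroup = record
            { isMagma = record
              { isEquivalence = record { refl = ≋-refl ; sym = ≋-sym ; trans = ≋-trans }
              ; ∙-cong = +ₚ-cong }
            ; assoc = +ₚ-assoc }
          ; identity = (λ _ → ≋-refl) , +ₚ-identityʳ }
        ; comm = +ₚ-comm } }

  open import Relation.Binary.Reasoning.Setoid (CommutativeMonoid.setoid +-monoid)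
  open import Algebra.Properties.CommutativeSemigroup (CommutativeMonoid.commutativeSemigroup +-monoid) using (x∙yz≈y∙xz; interchange)

  *ₚ-congʳ : ∀ f {g h} → g ≋ h → f *ₚ g ≋ f *ₚ h
  *ₚ-congʳ [] e = ≋-refl
  *ₚ-congʳ (a ∷ f) e = +ₚ-cong (scale-cong a e) (∷-cong refl (*ₚ-congʳ f e))

  *ₚ-zeroʳ : ∀ f → f *ₚ [] ≋ []
  *ₚ-zeroʳ [] = ≋-refl
  *ₚ-zeroʳ (a ∷ f) = ≋-trans (∷-cong refl (*ₚ-zeroʳ f)) 0∷[]≋[]

  -- Mirror image, in the second factor, of the defining clause of `*ₚ`; commutativity, and through
  -- it congruence in the first factor, rests on it.
  *ₚ-∷ : ∀ f b g → f *ₚ (b ∷ g) ≋ scale b f +ₚ (0# ∷ (f *ₚ g))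
  *ₚ-∷ [] b g = ≋-sym 0∷[]≋[]
  *ₚ-∷ (a ∷ f) b g = ∷-cong (cong (_+ 0#) (K.*-comm a b)) (begin
    scale a g +ₚ (f *ₚ (b ∷ g))                   ≈⟨ +ₚ-cong ≋-refl (*ₚ-∷ f b g) ⟩
    scale a g +ₚ (scale b f +ₚ (0# ∷ (f *ₚ g)))   ≈⟨ x∙yz≈y∙xz (scale a g) (scale b f) _ ⟩
    scale b f +ₚ (scale a g +ₚ (0# ∷ (f *ₚ g)))   ∎)

  *ₚ-comm : ∀ f g → f *ₚ g ≋ g *ₚ f
  *ₚ-comm [] g = ≋-sym (*ₚ-zeroʳ g)
  *ₚ-comm (a ∷ f) g = begin
    scale a g +ₚ (0# ∷ (f *ₚ g))   ≈⟨ +ₚ-cong ≋-refl (∷-cong refl (*ₚ-comm f g)) ⟩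
    scale a g +ₚ (0# ∷ (g *ₚ f))   ≈⟨ *ₚ-∷ g a f ⟨
    g *ₚ (a ∷ f)                   ∎

  *ₚ-cong : ∀ {f f′ g g′} → f ≋ f′ → g ≋ g′ → f *ₚ g ≋ f′ *ₚ g′
  *ₚ-cong {f} {f′} {g} {g′} e e′ = begin
    f *ₚ g     ≈⟨ *ₚ-congʳ f e′ ⟩
    f *ₚ g′    ≈⟨ *ₚ-comm f g′ ⟩
    g′ *ₚ f    ≈⟨ *ₚ-congʳ g′ e ⟩
    g′ *ₚ f′   ≈⟨ *ₚ-comm g′ f′ ⟩
    f′ *ₚ g′   ∎

  *ₚ-distribʳ : ∀ h f g → (f +ₚ g) *ₚ h ≋ (f *ₚ h) +ₚ (g *ₚ h)
  *ₚ-distribʳ h [] g = ≋-refl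
  *ₚ-distribʳ h (a ∷ f) [] = ≋-sym (+ₚ-identityʳ _)
  *ₚ-distribʳ h (a ∷ f) (b ∷ g) = begin
    scale (a + b) h +ₚ (0# ∷ ((f +ₚ g) *ₚ h))
      ≈⟨ +ₚ-cong (scale-distribʳ a b h) (∷-cong (sym (K.+-identityˡ 0#)) (*ₚ-distribʳ h f g)) ⟩
    (scale a h +ₚ scale b h) +ₚ ((0# ∷ (f *ₚ h)) +ₚ (0# ∷ (g *ₚ h)))
      ≈⟨ interchange (scale a h) (scale b h) _ _ ⟩
    (scale a h +ₚ (0# ∷ (f *ₚ h))) +ₚ (scale b h +ₚ (0# ∷ (g *ₚ h))) ∎

  scale-*ₚ : ∀ c f g → scale c f *ₚ g ≋ scale c (f *ₚ g)
  scale-*ₚ c [] g = ≋-refl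
  scale-*ₚ c (a ∷ f) g = begin
    scale (c * a) g +ₚ (0# ∷ (scale c f *ₚ g))      ≈⟨ +ₚ-cong (scale-* c a g) (∷-cong (sym (K.zeroʳ c)) (scale-*ₚ c f g)) ⟩
    scale c (scale a g) +ₚ scale c (0# ∷ (f *ₚ g))  ≈⟨ scale-distribˡ c (scale a g) (0# ∷ (f *ₚ g)) ⟨
    scale c (scale a g +ₚ (0# ∷ (f *ₚ g)))          ∎

  0∷-*ₚ : ∀ f g → (0# ∷ f) *ₚ g ≋ 0# ∷ (f *ₚ g)
  0∷-*ₚ f g = +ₚ-cong {g = 0# ∷ (f *ₚ g)} (scale-0 g) ≋-refl

  *ₚ-assoc : ∀ f g h → (f *ₚ g) *ₚ h ≋ f *ₚ (g *ₚ h)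
  *ₚ-assoc [] g h = ≋-refl
  *ₚ-assoc (a ∷ f) g h = begin
    (scale a g +ₚ (0# ∷ (f *ₚ g))) *ₚ h            ≈⟨ *ₚ-distribʳ h (scale a g) (0# ∷ (f *ₚ g)) ⟩
    (scale a g *ₚ h) +ₚ ((0# ∷ (f *ₚ g)) *ₚ h)     ≈⟨ +ₚ-cong (scale-*ₚ a g h) (≋-trans (0∷-*ₚ (f *ₚ g) h) (∷-cong refl (*ₚ-assoc f g h))) ⟩
    scale a (g *ₚ h) +ₚ (0# ∷ (f *ₚ (g *ₚ h)))     ∎

  *ₚ-identityˡ : ∀ f → const 1# *ₚ f ≋ f
  *ₚ-identityˡ f = ≋-trans (+ₚ-cong (scale-1 f) 0∷[]≋[]) (+ₚ-identityʳ f)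

  polynomial-ring : CommutativeRing 0ℓ 0ℓ
  polynomial-ring = record
    { Carrier = P ; _≈_ = _≋_ ; _+_ = _+ₚ_ ; _*_ = _*ₚ_ ; -_ = -ₚ_ ; 0# = [] ; 1# = const 1#
    ; isCommutativeRing = record
      { isRing = record
        { +-isAbelianGroup = record
          { isGroup = record
            { isMonoid = CommutativeMonoid.isMonoid +-monoid
            ; inverse = (λ f → ≋-trans (+ₚ-comm (-ₚ f) f) (+ₚ-inverseʳ f)) , +ₚ-inverseʳ
            ; ⁻¹-cong = -ₚ-cong }
          ; comm = +ₚ-comm }
        ; *-cong = *ₚ-cong
        ; *-assoc = *ₚ-assoc
        ; *-identity = *ₚ-identityˡ , λ f → ≋-trans (*ₚ-comm f (const 1#)) (*ₚ-identityˡ f)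
        ; distrib = (λ h f g → ≋-trans (*ₚ-comm h (f +ₚ g)) (≋-trans (*ₚ-distribʳ h f g) (+ₚ-cong (*ₚ-comm f h) (*ₚ-comm g h)))) , *ₚ-distribʳ }
      ; *-comm = *ₚ-comm } }

  const-* : ∀ a b → const (a * b) ≋ const a *ₚ const b
  const-* a b = ∷-cong (sym (K.+-identityʳ _)) ≋-refl

  const-0 : const 0# ≋ []
  const-0 = 0∷[]≋[]

  const-*ₚ : ∀ c f → const c *ₚ f ≋ scale c f
  const-*ₚ c f = ≋-trans (+ₚ-cong {g = 0# ∷ []} ≋-refl 0∷[]≋[]) (+ₚ-identityʳ _)

  T*ₚ : ∀ f → T *ₚ f ≋ 0# ∷ f
  T*ₚ f = ≋-trans (0∷-*ₚ (const 1#) f) (∷-cong refl (*ₚ-identityˡ f))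

  ∷≋ : ∀ a f → a ∷ f ≋ const a +ₚ T *ₚ f
  ∷≋ a f = ≋-trans (∷-cong (sym (K.+-identityʳ a)) ≋-refl) (+ₚ-cong {const a} ≋-refl (≋-sym (T*ₚ f)))

  coeff-natC : ∀ k f i → coeff (derivAux k f) i ≡ natC (k ℕ.+ i) * coeff f i
  coeff-natC k [] i = sym (K.zeroʳ _)
  coeff-natC k (a ∷ f) zero = cong (λ n → natC n * a) (sym (ℕₚ.+-identityʳ k))
  coeff-natC k (a ∷ f) (suc i) = trans (coeff-natC (suc k) f i) (cong (λ n → natC n * coeff f i) (sym (ℕₚ.+-suc k i)))

  coeff-deriv : ∀ f i → coeff (deriv f) i ≡ natC (suc i) * coeff f (suc i)
  coeff-deriv [] i = sym (K.zeroʳ _)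
  coeff-deriv (a ∷ f) i = coeff-natC 1 f i

  deriv-cong : ∀ {f g} → f ≋ g → deriv f ≋ deriv g
  deriv-cong {f} {g} e = pointwise λ i → trans (coeff-deriv f i)
    (trans (cong (natC (suc i) *_) (coeffs e (suc i))) (sym (coeff-deriv g i)))

  deriv-+ : ∀ f g → deriv (f +ₚ g) ≋ deriv f +ₚ deriv g
  deriv-+ f g = pointwise λ i → trans (coeff-deriv (f +ₚ g) i)
    (trans (cong (natC (suc i) *_) (coeff-+ f g (suc i))) (trans (K.distribˡ _ _ _)
      (sym (trans (coeff-+ (deriv f) (deriv g) i) (cong₂ _+_ (coeff-deriv f i) (coeff-deriv g i))))))

  -- (a + T f)′ = f + T f′. This trades the counter of `derivAux` for a recursion that suits the
  -- product rule.
  deriv-∷ : ∀ a f → deriv (a ∷ f) ≋ f +ₚ (0# ∷ deriv f)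
  deriv-∷ a f = pointwise λ i → trans (coeff-natC 1 f i) (sym (trans (coeff-+ f (0# ∷ deriv f) i) (go i)))
    where
    go : ∀ i → coeff f i + coeff (0# ∷ deriv f) i ≡ natC (suc i) * coeff f i
    go zero = solve 1 (λ x → x :+ :0 := (:1 :+ :0) :* x) refl (coeff f 0)
    go (suc i) = trans (cong (coeff f (suc i) +_) (coeff-deriv f i))
      (solve 2 (λ n x → x :+ n :* x := (:1 :+ n) :* x) refl (natC (suc i)) (coeff f (suc i)))

  deriv-scale : ∀ c f → deriv (scale c f) ≋ scale c (deriv f)
  deriv-scale c f = pointwise λ i → trans (coeff-deriv (scale c f) i)
    (trans (cong (natC (suc i) *_) (coeff-scale c f (suc i)))
      (trans (solve 3 (λ n c x → n :* (c :* x) := c :* (n :* x)) refl (natC (suc i)) c (coeff f (suc i)))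
        (sym (trans (coeff-scale c (deriv f) i) (cong (c *_) (coeff-deriv f i))))))

  deriv-* : ∀ f g → deriv (f *ₚ g) ≋ deriv f *ₚ g +ₚ f *ₚ deriv g
  deriv-* [] g = ≋-refl
  deriv-* (a ∷ f) g = begin
    deriv (scale a g +ₚ (0# ∷ fg))
      ≈⟨ ≋-trans (deriv-+ (scale a g) (0# ∷ fg)) (+ₚ-cong (deriv-scale a g) (deriv-∷ 0# fg)) ⟩
    scale a g′ +ₚ (fg +ₚ (0# ∷ deriv fg))
      ≈⟨ +ₚ-cong {scale a g′} ≋-refl (+ₚ-cong {fg} ≋-refl (∷-cong (sym (K.+-identityˡ 0#)) (deriv-* f g))) ⟩
    scale a g′ +ₚ (fg +ₚ ((0# ∷ (f′ *ₚ g)) +ₚ (0# ∷ (f *ₚ g′))))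
      ≈⟨ +ₚ-cong {scale a g′} ≋-refl (≋-sym (+ₚ-assoc fg _ _)) ⟩
    scale a g′ +ₚ ((fg +ₚ (0# ∷ (f′ *ₚ g))) +ₚ (0# ∷ (f *ₚ g′)))
      ≈⟨ x∙yz≈y∙xz (scale a g′) (fg +ₚ (0# ∷ (f′ *ₚ g))) (0# ∷ (f *ₚ g′)) ⟩
    (fg +ₚ (0# ∷ (f′ *ₚ g))) +ₚ (scale a g′ +ₚ (0# ∷ (f *ₚ g′)))
      ≈⟨ +ₚ-cong (begin
           deriv (a ∷ f) *ₚ g               ≈⟨ *ₚ-cong {g = g} (deriv-∷ a f) ≋-refl ⟩
           (f +ₚ (0# ∷ f′)) *ₚ g            ≈⟨ *ₚ-distribʳ g f (0# ∷ f′) ⟩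
           fg +ₚ (0# ∷ f′) *ₚ g             ≈⟨ +ₚ-cong {fg} ≋-refl (0∷-*ₚ f′ g) ⟩
           fg +ₚ (0# ∷ (f′ *ₚ g))           ∎) ≋-refl ⟨
    deriv (a ∷ f) *ₚ g +ₚ (a ∷ f) *ₚ g′ ∎
    where
    fg f′ g′ : P
    fg = f *ₚ g
    f′ = deriv f
    g′ = deriv g

  deriv-T : deriv T ≋ const 1#
  deriv-T = ∷-cong (solve 0 ((:1 :+ :0) :* :1 := :1) refl) ≋-refl

  deriv-isDerivation : IsDerivation polynomial-ring deriv
  deriv-isDerivation = record { δ-cong = deriv-cong ; δ-+ = deriv-+ ; δ-* = deriv-* }

-- The q-th power map on A.

module PolynomialFrobenius (F : FiniteField) (1<card : 1 ℕ.< FiniteField.card F) where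
  open FiniteField F
  open Poly F
  open FiniteFieldProperties F renaming (_^_ to _^ᶠ_)
  open PolynomialRing F
  private
    module K = CommutativeRing field-ring
    module A = CommutativeRing polynomial-ring
  open IntegerSolver polynomial-ring
  open Divides polynomial-ring
  open MonicPolynomials polynomial-ring
  open AdditivePowers polynomial-ring
  open ListFold A.*-commutativeMonoid {Carrier}
  open import Relation.Binary.Reasoning.Setoid A.setoid

  const-^ : ∀ a n → const (a ^ᶠ n) ≋ const a ^ n
  const-^ a zero = ≋-refl
  const-^ a (suc n) = ≋-trans (const-* a (a ^ᶠ n)) (*ₚ-congʳ (const a) (const-^ a n))

  const-fermat : ∀ a → const a ^ card ≋ const a
  const-fermat a = ≋-trans (≋-sym (const-^ a card)) (A.reflexive (cong const (fermat a)))

  const-unit : ∀ a → a ≢ 0# → ∃ λ u → const a *ₚ u ≋ const 1#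
  const-unit a a≢0 = let (a⁻¹ , e) = inverse a a≢0 in
    const a⁻¹ , ≋-trans (≋-sym (const-* a a⁻¹)) (A.reflexive (cong const e))

  private
    linearProduct-const : ∀ y xs → linearProduct (map const xs) y ≡ fold (λ a → y -ₚ const a) xs
    linearProduct-const y [] = refl
    linearProduct-const y (a ∷ xs) = cong ((y -ₚ const a) *ₚ_) (linearProduct-const y xs)

    constants-separated : Separated [] (map const elements)
    constants-separated = AllPairsₚ.map⁺ (AllPairs.map
      (λ {a} {b} a≢b → let (u , e) = const-unit (b + - a) (λ b-a≡0 → a≢b (sym (x∙y⁻¹≈ε⇒x≈y b a b-a≡0))) in
        u , ∣-resp (≋-trans (≋-sym (A.-‿inverseʳ (const 1#))) (+ₚ-cong {g = -ₚ const 1#} (≋-sym e) ≋-refl)) ∣0)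
      unique)
      where open import Algebra.Properties.Group K.+-group using (x∙y⁻¹≈ε⇒x≈y)

  -- By Fermat's theorem in F the q constants are roots of X^q - X, and their differences are units.
  -- The factor theorem with modulus `[]` then yields an identity in A.
  y^card-y : ∀ y → y ^ card -ₚ y ≋ fold (λ a → y -ₚ const a) elements
  y^card-y y = go card refl 1<card
    where
    open import Algebra.Properties.Group A.+-group using (x∙y⁻¹≈ε⇒x≈y)
    go : ∀ N → card ≡ N → 1 ℕ.< N → y ^ card -ₚ y ≋ fold (λ a → y -ₚ const a) elements
    go (suc zero) _ (s≤s ())
    go (suc (suc k)) eq _ = begin
      y ^ card -ₚ y                              ≡⟨ cong (λ n → y ^ n -ₚ y) eq ⟩
      y ^ suc (suc k) -ₚ y                       ≈⟨ eval-X^n-X k y ⟨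
      eval (X^ k -X) y                           ≈⟨ x∙y⁻¹≈ε⇒x≈y _ _ (0∣⇒≋0
        (factorisation (map const elements) (X^ k -X) (trans (Listₚ.length-map const elements) eq) constants-separated
          (Allₚ.map⁺ (All.universal (λ a → ∣-resp (≋-sym (root a)) ∣0) elements)) y)) ⟩
      linearProduct (map const elements) y       ≡⟨ linearProduct-const y elements ⟩
      fold (λ a → y -ₚ const a) elements         ∎
      where
      0∣⇒≋0 : ∀ {f} → [] ∣ f → f ≋ []
      0∣⇒≋0 (h ,ᵈ e) = ≋-trans (≋-sym e) (*ₚ-zeroʳ h)
      root : ∀ a → eval (X^ k -X) (const a) ≋ []
      root a = begin
        eval (X^ k -X) (const a)                ≈⟨ eval-X^n-X k (const a) ⟩
        const a ^ suc (suc k) -ₚ const a        ≡⟨ cong (λ n → const a ^ n -ₚ const a) eq ⟨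
        const a ^ card -ₚ const a               ≈⟨ +ₚ-cong {g = -ₚ const a} (const-fermat a) ≋-refl ⟩
        const a -ₚ const a                      ≈⟨ +ₚ-inverseʳ (const a) ⟩
        []                                      ∎

  -- y^q - y = ∏ (y - a) over all a in F, and this product is invariant under y ↦ 1 + y.
  [1+y]^card : ∀ y → (const 1# +ₚ y) ^ card ≋ const 1# +ₚ y ^ card
  [1+y]^card y = begin
    (const 1# +ₚ y) ^ card
      ≈⟨ split ((const 1# +ₚ y) ^ card) (const 1# +ₚ y) ⟩
    ((const 1# +ₚ y) ^ card -ₚ (const 1# +ₚ y)) +ₚ (const 1# +ₚ y)
      ≈⟨ A.+-congʳ (begin
        (const 1# +ₚ y) ^ card -ₚ (const 1# +ₚ y)        ≈⟨ y^card-y (const 1# +ₚ y) ⟩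
        fold (λ a → const 1# +ₚ y -ₚ const a) elements   ≈⟨ fold-↭ _ (↭-sym 1+-↭) ⟩
        fold (λ a → const 1# +ₚ y -ₚ const a) (map (1# +_) elements) ≈⟨ shift elements ⟩
        fold (λ a → y -ₚ const a) elements               ≈⟨ y^card-y y ⟨
        y ^ card -ₚ y                                    ∎) ⟩
    (y ^ card -ₚ y) +ₚ (const 1# +ₚ y)
      ≈⟨ cancel (y ^ card) y (const 1#) ⟩
    const 1# +ₚ y ^ card ∎
    where
    split : ∀ z y → z ≋ (z -ₚ y) +ₚ y
    split = solve 2 (λ z y → z := (z :- y) :+ y) ≋-refl
    cancel : ∀ z y o → (z -ₚ y) +ₚ (o +ₚ y) ≋ o +ₚ z
    cancel = solve 3 (λ z y o → (z :- y) :+ (o :+ y) := o :+ z) ≋-refl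
    translate : ∀ o y a → (o +ₚ y) -ₚ (o +ₚ a) ≋ y -ₚ a
    translate = solve 3 (λ o y a → (o :+ y) :- (o :+ a) := y :- a) ≋-refl
    shift : ∀ xs → fold (λ a → const 1# +ₚ y -ₚ const a) (map (1# +_) xs) ≋ fold (λ a → y -ₚ const a) xs
    shift [] = ≋-refl
    shift (a ∷ xs) = *ₚ-cong (translate (const 1#) y (const a)) (shift xs)

  -- For c ≠ 0 write c + y = c (1 + y/c) and use that c and 1/c are fixed by the q-th power.
  [c+y]^card : ∀ c y → (const c +ₚ y) ^ card ≋ const c +ₚ y ^ card
  [c+y]^card c y with c ≟ 0#
  ... | yes refl = begin
    (const 0# +ₚ y) ^ card      ≈⟨ ^-congˡ card (+ₚ-cong {g = y} const-0 ≋-refl) ⟩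
    y ^ card                    ≈⟨ +ₚ-cong {g = y ^ card} const-0 ≋-refl ⟨
    const 0# +ₚ y ^ card        ∎
  ... | no c≢0 with inverse c c≢0
  ... | c⁻¹ , cc⁻¹≡1 = begin
    (const c +ₚ y) ^ card
      ≈⟨ ^-congˡ card (factor y) ⟨
    (const c *ₚ (const 1# +ₚ const c⁻¹ *ₚ y)) ^ card
      ≈⟨ ^-distrib-* (const c) _ card ⟩
    const c ^ card *ₚ (const 1# +ₚ const c⁻¹ *ₚ y) ^ card
      ≈⟨ *ₚ-cong (const-fermat c) ([1+y]^card (const c⁻¹ *ₚ y)) ⟩
    const c *ₚ (const 1# +ₚ (const c⁻¹ *ₚ y) ^ card)
      ≈⟨ *ₚ-congʳ (const c) (A.+-congˡ (≋-trans (^-distrib-* (const c⁻¹) y card) (*ₚ-cong (const-fermat c⁻¹) ≋-refl))) ⟩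
    const c *ₚ (const 1# +ₚ const c⁻¹ *ₚ y ^ card)
      ≈⟨ factor (y ^ card) ⟩
    const c +ₚ y ^ card ∎
    where
    factor : ∀ z → const c *ₚ (const 1# +ₚ const c⁻¹ *ₚ z) ≋ const c +ₚ z
    factor z = begin
      const c *ₚ (const 1# +ₚ const c⁻¹ *ₚ z)
        ≈⟨ A.distribˡ (const c) (const 1#) (const c⁻¹ *ₚ z) ⟩
      const c *ₚ const 1# +ₚ const c *ₚ (const c⁻¹ *ₚ z)
        ≈⟨ +ₚ-cong (A.*-identityʳ (const c)) (≋-trans (≋-sym (*ₚ-assoc (const c) (const c⁻¹) z))
             (≋-trans (*ₚ-cong {g = z} (≋-trans (≋-sym (const-* c c⁻¹)) (A.reflexive (cong const cc⁻¹≡1))) ≋-refl) (*ₚ-identityˡ z))) ⟩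
      const c +ₚ z ∎

  private
    -- This is f(T^q) in Horner form. It is plainly additive in f, and it equals f^q by peeling off
    -- one constant coefficient at a time.
    σ : P → P
    σ [] = []
    σ (a ∷ f) = const a +ₚ T ^ card *ₚ σ f

    σ≋ : ∀ f → f ^ card ≋ σ f
    σ≋ [] = 0^ card 1<card
      where
      0^ : ∀ n → 1 ℕ.< n → [] ^ n ≋ []
      0^ (suc n) _ = ≋-refl
    σ≋ (a ∷ f) = begin
      (a ∷ f) ^ card                         ≈⟨ ^-congˡ card (∷≋ a f) ⟩
      (const a +ₚ T *ₚ f) ^ card             ≈⟨ [c+y]^card a (T *ₚ f) ⟩
      const a +ₚ (T *ₚ f) ^ card             ≈⟨ A.+-congˡ {const a} (≋-trans (^-distrib-* T f card) (*ₚ-congʳ (T ^ card) (σ≋ f))) ⟩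
      const a +ₚ T ^ card *ₚ σ f             ∎

    rearrange : ∀ a b t x y → (a +ₚ b) +ₚ t *ₚ (x +ₚ y) ≋ (a +ₚ t *ₚ x) +ₚ (b +ₚ t *ₚ y)
    rearrange = solve 5 (λ a b t x y → (a :+ b) :+ t :* (x :+ y) := (a :+ t :* x) :+ (b :+ t :* y)) ≋-refl

    σ-+ : ∀ f g → σ (f +ₚ g) ≋ σ f +ₚ σ g
    σ-+ [] g = ≋-refl
    σ-+ (a ∷ f) [] = ≋-sym (+ₚ-identityʳ _)
    σ-+ (a ∷ f) (b ∷ g) = begin
      (const a +ₚ const b) +ₚ T ^ card *ₚ σ (f +ₚ g)          ≈⟨ A.+-congˡ (*ₚ-congʳ (T ^ card) (σ-+ f g)) ⟩
      (const a +ₚ const b) +ₚ T ^ card *ₚ (σ f +ₚ σ g)        ≈⟨ rearrange (const a) (const b) (T ^ card) (σ f) (σ g) ⟩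
      (const a +ₚ T ^ card *ₚ σ f) +ₚ (const b +ₚ T ^ card *ₚ σ g) ∎

  frobenius : Additive card
  frobenius f g = ≋-trans (σ≋ (f +ₚ g)) (≋-trans (σ-+ f g) (≋-sym (+ₚ-cong (σ≋ f) (σ≋ g))))

  -- Modulo a divisor of T^N - T, where N = q^m, raising to the power N is an F-algebra endomorphism fixing T.
  fixed-mod : ∀ {℘} m → ℘ ∣ T ^ (card ℕ.^ m) -ₚ T → ∀ f → ℘ ∣ f ^ (card ℕ.^ m) -ₚ f
  fixed-mod {℘} m d [] = ∣-resp (≋-sym (≋-trans (+ₚ-identityʳ _) (0^ N 1≤N))) ∣0
    where
    N : ℕ
    N = card ℕ.^ m
    1≤N : 1 ℕ.≤ N
    1≤N = ℕₚ.m^n>0 card {{ℕ.>-nonZero (ℕₚ.<⇒≤ 1<card)}} m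
    0^ : ∀ n → 1 ℕ.≤ n → [] ^ n ≋ []
    0^ (suc n) _ = ≋-refl
  fixed-mod {℘} m d (a ∷ f) = ∣-resp (begin
    (T ^ N -ₚ T) *ₚ f ^ N +ₚ T *ₚ (f ^ N -ₚ f)
      ≈⟨ identity (T ^ N) T (f ^ N) f (const a) ⟩
    (const a +ₚ T ^ N *ₚ f ^ N) -ₚ (const a +ₚ T *ₚ f)
      ≈⟨ A.+-congʳ (+ₚ-cong (fixed-^ card m (const-fermat a)) (^-distrib-* T f N)) ⟨
    (const a ^ N +ₚ (T *ₚ f) ^ N) -ₚ (const a +ₚ T *ₚ f)
      ≈⟨ A.+-congʳ (additive-^ card m frobenius (const a) (T *ₚ f)) ⟨
    (const a +ₚ T *ₚ f) ^ N -ₚ (const a +ₚ T *ₚ f)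
      ≈⟨ +ₚ-cong (^-congˡ N (∷≋ a f)) (-ₚ-cong (∷≋ a f)) ⟨
    (a ∷ f) ^ N -ₚ (a ∷ f) ∎)
    (∣-+ (∣-*ʳ (f ^ N) d) (∣-*ˡ T (fixed-mod m d f)))
    where
    N : ℕ
    N = card ℕ.^ m
    identity : ∀ u t v f a → (u -ₚ t) *ₚ v +ₚ t *ₚ (v -ₚ f) ≋ (a +ₚ u *ₚ v) -ₚ (a +ₚ t *ₚ f)
    identity = solve 5 (λ u t v f a → (u :- t) :* v :+ t :* (v :- f) := (a :+ u :* v) :- (a :+ t :* f)) ≋-refl

-- Euclidean division and residues modulo an irreducible polynomial.

length-cartesianProductWith : {A B C : Set} (f : A → B → C) (xs : List A) (ys : List B) →
                              length (cartesianProductWith f xs ys) ≡ length xs ℕ.* length ys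
length-cartesianProductWith f [] ys = refl
length-cartesianProductWith f (x ∷ xs) ys = trans (Listₚ.length-++ (map (f x) ys))
  (cong₂ ℕ._+_ (Listₚ.length-map (f x) ys) (length-cartesianProductWith f xs ys))

module PolynomialDivision (F : FiniteField) where
  open FiniteField F
  open Poly F
  open FiniteFieldProperties F using (field-ring)
  open PolynomialRing F
  private
    module K = CommutativeRing field-ring
    module A = CommutativeRing polynomial-ring
    module KS = IntegerSolver field-ring
  open IntegerSolver polynomial-ring
  open Divides polynomial-ring
  open MonicPolynomials polynomial-ring
  open import Relation.Binary.Reasoning.Setoid A.setoid

  -- Coefficient lists may end in zeros and the zero polynomial has no degree, so only a strict
  -- upper bound is recorded.
  DegLt : ℕ → P → Set
  DegLt n f = ∀ i → n ℕ.≤ i → coeff f i ≡ 0#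

  degLt-sub : ∀ {n f g} → DegLt n f → DegLt n g → DegLt n (f -ₚ g)
  degLt-sub {n} {f} {g} df dg i n≤i = ≡.trans (coeff-+ f (-ₚ g) i)
    (trans (cong₂ _+_ (df i n≤i) (trans (coeff-neg g i) (cong -_ (dg i n≤i)))) (K.-‿inverseʳ 0#))

  ≋-from-sub : ∀ {f g} → f -ₚ g ≋ [] → f ≋ g
  ≋-from-sub {f} {g} = x∙y⁻¹≈ε⇒x≈y f g
    where open import Algebra.Properties.Group A.+-group using (x∙y⁻¹≈ε⇒x≈y)

  coeff-*-suc : ∀ a h g i → coeff ((a ∷ h) *ₚ g) (suc i) ≡ a * coeff g (suc i) + coeff (h *ₚ g) i
  coeff-*-suc a h g i = trans (coeff-+ (scale a g) (0# ∷ (h *ₚ g)) (suc i)) (cong (_+ coeff (h *ₚ g) i) (coeff-scale a g (suc i)))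

  -- If f = h g + r, then a + T f = (T h) g + (a + T r); here a + T r has degree at most k, and
  -- subtracting u g with u its coefficient at T^k brings it below k.
  division : ∀ {k g} → MonicOfDegree k g → ∀ f → ∃ λ h → ∃ λ r → f ≋ h *ₚ g +ₚ r × DegLt k r
  division m [] = [] , [] , ≋-refl , λ _ _ → refl
  division {k} {g} (lead , above) (a ∷ f) with division (lead , above) f
  ... | h , r , f≋ , dr = u ∷ h , (a ∷ r) -ₚ scale u g , decomposition , small
    where
    u : Carrier
    u = coeff (a ∷ r) k
    regroup : ∀ s t c → t +ₚ s ≋ (c +ₚ t) +ₚ (s -ₚ c)
    regroup = solve 3 (λ s t c → t :+ s := (c :+ t) :+ (s :- c)) ≋-refl
    decomposition : a ∷ f ≋ (u ∷ h) *ₚ g +ₚ ((a ∷ r) -ₚ scale u g)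
    decomposition = begin
      a ∷ f                                      ≈⟨ ∷-cong (sym (K.+-identityˡ a)) f≋ ⟩
      (0# ∷ (h *ₚ g)) +ₚ (a ∷ r)                 ≈⟨ regroup (a ∷ r) (0# ∷ (h *ₚ g)) (scale u g) ⟩
      (u ∷ h) *ₚ g +ₚ ((a ∷ r) -ₚ scale u g)     ∎
    coeff-r : ∀ i → coeff ((a ∷ r) -ₚ scale u g) i ≡ coeff (a ∷ r) i + - (u * coeff g i)
    coeff-r i = trans (coeff-+ (a ∷ r) (-ₚ scale u g) i)
      (cong (coeff (a ∷ r) i +_) (trans (coeff-neg (scale u g) i) (cong -_ (coeff-scale u g i))))
    small : DegLt k ((a ∷ r) -ₚ scale u g)
    small i k≤i with ℕₚ.m≤n⇒m<n∨m≡n k≤i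
    ... | inj₂ refl = trans (coeff-r k) (trans (cong (λ x → u + - (u * x)) lead)
      (KS.solve 1 (λ u → u KS.:- u KS.:* KS.:1 KS.:= KS.:0) refl u))
    small (suc i) _ | inj₁ (s≤s k≤i) = trans (coeff-r (suc i)) (trans
      (cong₂ (λ x y → x + - (u * y)) (dr i k≤i) (above (suc i) (s≤s k≤i)))
      (KS.solve 1 (λ u → KS.:0 KS.:- u KS.:* KS.:0 KS.:= KS.:0) refl u))

  -- As g has leading coefficient 1, the top coefficient of a non-zero h would survive in h g. The
  -- tail of h is killed first; then h g is a g, whose coefficient at T^k is a.
  multiple-too-small : ∀ {k g} → MonicOfDegree k g → ∀ h → DegLt k (h *ₚ g) → h ≋ []
  multiple-too-small m [] d = ≋-refl
  multiple-too-small {k} {g} (lead , above) (a ∷ h) d = ≋-trans (∷-cong a≡0 h≋[]) 0∷[]≋[]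
    where
    h≋[] : h ≋ []
    h≋[] = multiple-too-small (lead , above) h λ i k≤i → trans (KS.solve 2 (λ a x → x KS.:= a KS.:* KS.:0 KS.:+ x) refl a (coeff (h *ₚ g) i))
      (trans (cong (λ y → a * y + coeff (h *ₚ g) i) (sym (above (suc i) (s≤s k≤i))))
        (trans (sym (coeff-*-suc a h g i)) (d (suc i) (ℕₚ.m≤n⇒m≤1+n k≤i))))
    a≡0 : a ≡ 0#
    a≡0 = trans (sym (K.*-identityʳ a)) (trans (cong (a *_) (sym lead)) (trans (sym (coeff-scale a g k))
      (trans (sym (coeffs scale≋ k)) (d k ℕₚ.≤-refl))))
      where
      scale≋ : (a ∷ h) *ₚ g ≋ scale a g
      scale≋ = begin
        scale a g +ₚ (0# ∷ (h *ₚ g))  ≈⟨ +ₚ-cong {scale a g} ≋-refl (≋-trans (∷-cong refl (*ₚ-cong {g = g} h≋[] ≋-refl)) 0∷[]≋[]) ⟩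
        scale a g +ₚ []               ≈⟨ +ₚ-identityʳ _ ⟩
        scale a g                     ∎

  multiple-small⇒≋[] : ∀ {k g f} → MonicOfDegree k g → g ∣ f → DegLt k f → f ≋ []
  multiple-small⇒≋[] {g = g} m (h ,ᵈ e) d = ≋-trans (≋-sym e)
    (*ₚ-cong {g = g} (multiple-too-small m h (λ i k≤i → trans (coeffs e i) (d i k≤i))) ≋-refl)

  monic-regular : ∀ {k g} → MonicOfDegree k g → ∀ f → g *ₚ f ≋ [] → f ≋ []
  monic-regular {g = g} m f e = multiple-too-small m f λ i _ → coeffs (≋-trans (*ₚ-comm f g) e) i

  -- Passes from coefficient lists to the encoding used by the factor theorem, with f as the value
  -- of f(X) at X = T.
  monic-vector : ∀ d f → MonicOfDegree d f → Σ (Vec Carrier d) λ v → f ≋ eval (Vec.map const v) T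
  monic-vector zero [] (lead , _) = [] , pointwise λ { zero → lead ; (suc i) → refl }
  monic-vector zero (a ∷ f) (lead , above) = [] , pointwise λ { zero → lead ; (suc i) → above (suc i) (s≤s z≤n) }
  -- A contradictory case, as `lead` says 0 = 1; padding with zeros treats it like any other list.
  monic-vector (suc d) [] (lead , above) = let (v , e) = monic-vector d [] (lead , λ _ _ → refl) in
    0# ∷ v , (begin
      []                                          ≈⟨ *ₚ-zeroʳ T ⟨
      T *ₚ []                                     ≈⟨ *ₚ-congʳ T e ⟩
      T *ₚ eval (Vec.map const v) T               ≈⟨ +ₚ-cong const-0 ≋-refl ⟨
      const 0# +ₚ T *ₚ eval (Vec.map const v) T   ∎)
  monic-vector (suc d) (a ∷ f) (lead , above) = let (v , e) = monic-vector d f (lead , λ i d<i → above (suc i) (s≤s d<i)) in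
    a ∷ v , ≋-trans (∷≋ a f) (+ₚ-cong {const a} ≋-refl (*ₚ-congʳ T e))

module IrreduciblePolynomial (F : FiniteField) (1<card : 1 ℕ.< FiniteField.card F)
  (d : ℕ) (℘ : Poly.P F) (monic : Poly.MonicOfDegree F d ℘) (irreducible : Poly.Irreducible F ℘) where
  open FiniteField F
  open Poly F
  open FiniteFieldProperties F using (field-ring)
  open PolynomialRing F
  open PolynomialDivision F
  open PolynomialFrobenius F 1<card using (const-unit; const-fermat; fixed-mod)
  private
    module K = CommutativeRing field-ring
    module A = CommutativeRing polynomial-ring
  open IntegerSolver polynomial-ring
  open Divides polynomial-ring
  open MonicPolynomials polynomial-ring using (Separated)
  open import Relation.Binary.Reasoning.Setoid A.setoid

  ℘∤1 : ¬ ℘ ∣ const 1#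
  ℘∤1 (h ,ᵈ e) = proj₁ irreducible (h , coeffs e)

  unit⇒coprime : ∀ {f} g → g *ₚ f ≋ const 1# → Coprime ℘ f
  unit⇒coprime {f} g e = g , ∣-resp (≋-sym (≋-trans (+ₚ-cong {g = -ₚ const 1#} (≋-trans (*ₚ-comm f g) e) ≋-refl) (+ₚ-inverseʳ (const 1#)))) ∣0

  -- Let ℘ = h g + r. If r is a unit modulo ℘, then so is g, since h g ≡ - r. If r = 0,
  -- irreducibility makes h or g a unit; a unit h would make g a multiple of ℘ of too small a
  -- degree.
  monic⇒coprime : ∀ {k g} → MonicOfDegree k g → k ℕ.< d →
                  (∀ r → DegLt k r → r ≋ [] ⊎ Coprime ℘ r) → Coprime ℘ g
  monic⇒coprime {k} {g} m k<d smaller with division m ℘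
  ... | h , r , ℘≋ , dr with smaller r dr
  ... | inj₂ (s , r*s≡1) = -ₚ (h *ₚ s) , ∣-resp
    (≋-trans (A.+-congˡ {r *ₚ s -ₚ const 1#} (-ₚ-cong (*ₚ-cong {g = s} ℘≋ ≋-refl))) (identity r s h g (const 1#)))
    (∣-sub r*s≡1 (∣-*ʳ s ∣-refl))
    where
    identity : ∀ r s h g o → (r *ₚ s -ₚ o) -ₚ (h *ₚ g +ₚ r) *ₚ s ≋ g *ₚ (-ₚ (h *ₚ s)) -ₚ o
    identity = solve 5 (λ r s h g o → (r :* s :- o) :- (h :* g :+ r) :* s := g :* (:- (h :* s)) :- o) ≋-refl
  ... | inj₁ r≋[] = [ h-unit , (λ (v , v*g≈1) → unit⇒coprime v (pointwise v*g≈1)) ]′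
    (proj₂ irreducible h g (coeffs (≋-sym ℘≋hg)))
    where
    ℘≋hg : ℘ ≋ h *ₚ g
    ℘≋hg = ≋-trans ℘≋ (≋-trans (A.+-congˡ {h *ₚ g} r≋[]) (+ₚ-identityʳ _))
    h-unit : IsUnit h → Coprime ℘ g
    h-unit (v , v*h≈1) = ⊥-elim (1≢0 (trans (sym (proj₁ m)) (coeffs g≋[] k)))
      where
      g≋[] : g ≋ []
      g≋[] = multiple-small⇒≋[] monic (v ,ᵈ (begin
        v *ₚ ℘         ≈⟨ *ₚ-congʳ v ℘≋hg ⟩
        v *ₚ (h *ₚ g)  ≈⟨ *ₚ-assoc v h g ⟨
        v *ₚ h *ₚ g    ≈⟨ *ₚ-cong {v *ₚ h} {g = g} (pointwise v*h≈1) ≋-refl ⟩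
        const 1# *ₚ g  ≈⟨ *ₚ-identityˡ g ⟩
        g              ∎)) (λ i d≤i → proj₂ m i (ℕₚ.<-≤-trans k<d d≤i))

  -- Euclid: divide ℘ by f, normalised to be monic; the remainder has smaller degree than f.
  small⇒coprime : ∀ k → k ℕ.≤ d → ∀ f → DegLt k f → f ≋ [] ⊎ Coprime ℘ f
  small⇒coprime zero _ f df = inj₁ (pointwise λ i → df i z≤n)
  small⇒coprime (suc k) k<d f df with coeff f k ≟ 0#
  ... | yes e = small⇒coprime k (ℕₚ.<⇒≤ k<d) f λ i k≤i →
    [ df i , (λ { refl → e }) ]′ (ℕₚ.m≤n⇒m<n∨m≡n k≤i)
  ... | no u≢0 with inverse (coeff f k) u≢0
  ... | u⁻¹ , uu⁻¹≡1 = inj₂ (let (w , w-inverse) = monic⇒coprime {g = scale u⁻¹ f} monic-g k<d (small⇒coprime k (ℕₚ.<⇒≤ k<d)) in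
    const u⁻¹ *ₚ w , ∣-resp (+ₚ-cong {g = -ₚ const 1#} (begin
      scale u⁻¹ f *ₚ w        ≈⟨ *ₚ-cong {g = w} (const-*ₚ u⁻¹ f) ≋-refl ⟨
      const u⁻¹ *ₚ f *ₚ w     ≈⟨ *ₚ-cong {g = w} (*ₚ-comm (const u⁻¹) f) ≋-refl ⟩
      f *ₚ const u⁻¹ *ₚ w     ≈⟨ *ₚ-assoc f (const u⁻¹) w ⟩
      f *ₚ (const u⁻¹ *ₚ w)   ∎) ≋-refl) w-inverse)
    where
    monic-g : MonicOfDegree k (scale u⁻¹ f)
    monic-g = trans (coeff-scale u⁻¹ f k) (trans (K.*-comm _ _) uu⁻¹≡1)
            , λ i k<i → trans (coeff-scale u⁻¹ f i) (trans (cong (u⁻¹ *_) (df i k<i)) (K.zeroʳ u⁻¹))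

  ∣-or-coprime : ∀ f → ℘ ∣ f ⊎ Coprime ℘ f
  ∣-or-coprime f with division monic f
  ... | h , r , f≋ , dr with small⇒coprime d ℕₚ.≤-refl r dr
  ... | inj₁ r≋[] = inj₁ (h ,ᵈ ≋-sym (≋-trans f≋ (≋-trans (A.+-congˡ {h *ₚ ℘} r≋[]) (+ₚ-identityʳ _))))
  ... | inj₂ κ = inj₂ (coprime-≡ {℘} {r} {f} (∣-resp
    (≋-trans (identity h ℘ r) (A.+-congˡ {r} (-ₚ-cong (≋-sym f≋)))) (∣-neg (∣-*ˡ h ∣-refl))) κ)
    where
    identity : ∀ h g r → -ₚ (h *ₚ g) ≋ r -ₚ (h *ₚ g +ₚ r)
    identity = solve 3 (λ h g r → :- (h :* g) := r :- (h :* g :+ r)) ≋-refl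

  vectors : ∀ n → List (Vec Carrier n)
  vectors zero = [] ∷ []
  vectors (suc n) = cartesianProductWith _∷_ elements (vectors n)

  vectors-length : ∀ n → length (vectors n) ≡ card ℕ.^ n
  vectors-length zero = refl
  vectors-length (suc n) = trans (length-cartesianProductWith _∷_ elements (vectors n)) (cong (card ℕ.*_) (vectors-length n))

  vectors-unique : ∀ n → Unique (vectors n)
  vectors-unique zero = [] ∷ []
  vectors-unique (suc n) = Uniqueₚ.cartesianProductWith⁺ _∷_ Vecₚ.∷-injective unique (vectors-unique n)

  toList-degLt : ∀ {n} (v : Vec Carrier n) → DegLt n (Vec.toList v)
  toList-degLt [] i _ = refl
  toList-degLt (a ∷ v) (suc i) (s≤s n≤i) = toList-degLt v i n≤i

  toList-≋-injective : ∀ {n} (v w : Vec Carrier n) → Vec.toList v ≋ Vec.toList w → v ≡ w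
  toList-≋-injective [] [] _ = refl
  toList-≋-injective (a ∷ v) (b ∷ w) e = cong₂ _∷_ (coeffs e 0) (toList-≋-injective v w (pointwise λ i → coeffs e (suc i)))

  residues : List P
  residues = map Vec.toList (vectors d)

  residues-length : length residues ≡ card ℕ.^ d
  residues-length = trans (Listₚ.length-map Vec.toList (vectors d)) (vectors-length d)

  -- The difference of two distinct ones is non-zero of degree below d, so Euclid's algorithm
  -- inverts it modulo ℘.
  residues-separated : Separated ℘ residues
  residues-separated = AllPairsₚ.map⁺ (AllPairs.map (λ {v} {w} v≢w →
    [ (λ e → ⊥-elim (v≢w (sym (toList-≋-injective w v (≋-from-sub e))))) , (λ κ → κ) ]′
      (small⇒coprime d ℕₚ.≤-refl (Vec.toList w -ₚ Vec.toList v) (degLt-sub {d} {Vec.toList w} {Vec.toList v} (toList-degLt w) (toList-degLt v))))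
    (vectors-unique d))

-- Polynomials with zero derivative are p-th powers.

module PthRoots (F : FiniteField) (p-1 : ℕ) (p-prime : Prime (suc p-1))
  (natC-p : FiniteField.natC F (suc p-1) ≡ FiniteField.0# F) where
  open FiniteField F
  open Poly F
  open FiniteFieldProperties F renaming (_^_ to _^ᶠ_)
  open PolynomialRing F
  private
    module K = CommutativeRing field-ring
    module A = CommutativeRing polynomial-ring
  open Divides polynomial-ring
  open AdditivePowers polynomial-ring
  open PrimeCharacteristic polynomial-ring using (additive-prime)
  open import Algebra.Properties.Semiring.Exp K.semiring using () renaming (^-assocʳ to ^ᶠ-assocʳ)
  open import Algebra.Definitions.RawMonoid A.+-rawMonoid using () renaming (_×_ to _·ₚ_)
  open import Relation.Binary.Reasoning.Setoid A.setoid

  p : ℕ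
  p = suc p-1

  p∣card : p ∣ℕ card
  p∣card = natC≡0⇒∣ p-prime natC-p natC-card

  p≤card : p ℕ.≤ card
  p≤card = ℕ∣.∣⇒≤ {{ℕ.>-nonZero 1≤card}} p∣card

  1<card : 1 ℕ.< card
  1<card = ℕₚ.<-≤-trans (ℕ.nonTrivial⇒n>1 p {{prime⇒nonTrivial p-prime}}) p≤card

  const-natC : ∀ n → n ·ₚ const 1# ≋ const (natC n)
  const-natC zero = ≋-sym const-0
  const-natC (suc n) = A.+-congˡ (const-natC n)

  natC≡0⇒·≋[] : ∀ n → natC n ≡ 0# → n ·ₚ const 1# ≋ []
  natC≡0⇒·≋[] n e = ≋-trans (const-natC n) (≋-trans (A.reflexive (cong const e)) const-0)

  additive-p : Additive p
  additive-p = additive-prime p-prime (natC≡0⇒·≋[] p natC-p)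

  open PolynomialFrobenius F 1<card using (const-^)

  -- With q = m p the root is b^m, because b^(m p) = b^q = b.
  constant-root : ∀ b → ∃ λ r → const r ^ p ≋ const b
  constant-root b = let ℕ∣.divides m card≡m*p = p∣card in
    b ^ᶠ m , ≋-trans (≋-sym (const-^ (b ^ᶠ m) p)) (A.reflexive (cong const
      (trans (^ᶠ-assocʳ b m p) (trans (cong (b ^ᶠ_) (sym card≡m*p)) (fermat b)))))

  T^*ₚ : ∀ n f → T ^ n *ₚ f ≋ replicate n 0# ++ f
  T^*ₚ zero f = *ₚ-identityˡ f
  T^*ₚ (suc n) f = ≋-trans (*ₚ-assoc T (T ^ n) f) (≋-trans (T*ₚ _) (∷-cong refl (T^*ₚ n f)))

  coeff-shift-< : ∀ n f i → i ℕ.< n → coeff (replicate n 0# ++ f) i ≡ 0#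
  coeff-shift-< (suc n) f zero _ = refl
  coeff-shift-< (suc n) f (suc i) (s≤s i<n) = coeff-shift-< n f i i<n

  coeff-shift-+ : ∀ n f i → coeff (replicate n 0# ++ f) (n ℕ.+ i) ≡ coeff f i
  coeff-shift-+ zero f i = refl
  coeff-shift-+ (suc n) f i = coeff-shift-+ n f i

  coeff-drop : ∀ n f i → coeff (drop n f) i ≡ coeff f (n ℕ.+ i)
  coeff-drop zero f i = refl
  coeff-drop (suc n) [] i = refl
  coeff-drop (suc n) (a ∷ f) i = coeff-drop n f i

  natC-p+ : ∀ i → natC (p ℕ.+ i) ≡ natC i
  natC-p+ i = trans (natC-+ p i) (trans (cong (_+ natC i) natC-p) (K.+-identityˡ _))

  -- The coefficients at 0 < i < p vanish, so f = b + T^p g, where g inherits the hypothesis because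
  -- `natC` has period p. If b = r^p and g = a^p, then f = (r + T a)^p. The bound `N` drives the
  -- recursion, which drops p coefficients at once.
  pth-root : ∀ N f → length f ℕ.≤ N → (∀ i → natC i * coeff f i ≡ 0#) → ∃ λ a → f ≋ a ^ p
  pth-root N [] _ _ = [] , ≋-refl
  pth-root (suc N) (b ∷ f) (s≤s |f|≤N) vanish =
    let (r , r^p≋b) = constant-root b
        (a , g≋a^p) = pth-root N (drop p-1 f)
          (ℕₚ.≤-trans (ℕₚ.≤-reflexive (Listₚ.length-drop p-1 f)) (ℕₚ.≤-trans (ℕₚ.m∸n≤m (length f) p-1) |f|≤N))
          (λ i → trans (cong₂ _*_ (sym (natC-p+ i)) (coeff-drop p (b ∷ f) i)) (vanish (p ℕ.+ i)))
    in const r +ₚ T *ₚ a , (begin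
      b ∷ f                                          ≈⟨ pointwise decompose ⟩
      const b +ₚ (replicate p 0# ++ drop p-1 f)      ≈⟨ A.+-congˡ {const b} (T^*ₚ p (drop p-1 f)) ⟨
      const b +ₚ T ^ p *ₚ drop p-1 f                 ≈⟨ +ₚ-cong (≋-sym r^p≋b) (*ₚ-congʳ (T ^ p) g≋a^p) ⟩
      const r ^ p +ₚ T ^ p *ₚ a ^ p                  ≈⟨ A.+-congˡ {const r ^ p} (^-distrib-* T a p) ⟨
      const r ^ p +ₚ (T *ₚ a) ^ p                    ≈⟨ additive-p (const r) (T *ₚ a) ⟨
      (const r +ₚ T *ₚ a) ^ p                        ∎)
    where
    decompose : ∀ i → coeff (b ∷ f) i ≡ coeff (const b +ₚ (replicate p 0# ++ drop p-1 f)) i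
    decompose zero = sym (K.+-identityʳ b)
    decompose (suc i) with suc i ℕₚ.<? p
    ... | yes i<p = trans
      -- For 0 < i < p the prime p does not divide i, so i is non-zero in F and the coefficient must
      -- vanish.
      (no-zero-divisors (vanish (suc i)) λ e → ℕₚ.<⇒≱ i<p (ℕ∣.∣⇒≤ (natC≡0⇒∣ p-prime natC-p e)))
      (sym (coeff-shift-< p (drop p-1 f) (suc i) i<p))
    ... | no i≮p = trans (cong (coeff (b ∷ f)) (sym p+j≡i)) (trans (sym (coeff-drop p (b ∷ f) j))
      (trans (sym (coeff-shift-+ p (drop p-1 f) j)) (cong (coeff (replicate p 0# ++ drop p-1 f)) p+j≡i)))
      where
      j : ℕ
      j = suc i ℕ.∸ p
      p+j≡i : p ℕ.+ j ≡ suc i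
      p+j≡i = ℕₚ.m+[n∸m]≡n (ℕₚ.≮⇒≥ i≮p)

  deriv≋[]⇒pth-power : ∀ f → deriv f ≋ [] → ∃ λ a → f ≋ a ^ p
  deriv≋[]⇒pth-power f e = pth-root (length f) f ℕₚ.≤-refl λ
    { zero → K.zeroˡ _ ; (suc i) → trans (sym (coeff-deriv f i)) (coeffs e i) }

-- Primes with prescribed derivative.

module FixedDerivativePrimes (F : FiniteField) (p-1 : ℕ) (p-prime : Prime (suc p-1))
  (natC-p : FiniteField.natC F (suc p-1) ≡ FiniteField.0# F)
  (k : ℕ) (c : FiniteField.Carrier F) (c≢0 : c ≢ FiniteField.0# F) where
  open FiniteField F
  open Poly F
  open FiniteFieldProperties F renaming (_^_ to _^ᶠ_)
  open PolynomialRing F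
  open PolynomialDivision F
  open PthRoots F p-1 p-prime natC-p
  open PolynomialFrobenius F 1<card using (const-^; const-unit; const-fermat; fixed-mod; frobenius)
  private
    module K = CommutativeRing field-ring
    module A = CommutativeRing polynomial-ring
    module D = Divides polynomial-ring
    module δ = Derivation deriv-isDerivation
    module C = Carlitz polynomial-ring card 1<card frobenius T
  open D using (_^_)
  open import Relation.Binary.Reasoning.Setoid A.setoid

  -- Writing d as k + 2 builds in d > 1, so that n = d - 1 is positive.
  n d : ℕ
  n = suc k
  d = suc n

  e : Carrier
  e = powC (- 1#) n * c

  -- The recursions of the statement match those of the abstract part clause by clause, so the
  -- translations are equalities of lists and not merely `≋`.
  ^ₚ≡^ : ∀ f m → f ^ₚ m ≡ f ^ m
  ^ₚ≡^ f zero = refl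
  ^ₚ≡^ f (suc m) = cong (f *ₚ_) (^ₚ≡^ f m)

  powC≡^ᶠ : ∀ x m → powC x m ≡ x ^ᶠ m
  powC≡^ᶠ x zero = refl
  powC≡^ᶠ x (suc m) = cong (x *_) (powC≡^ᶠ x m)

  bracket≡ : ∀ m → bracket m ≡ C.bracket m
  bracket≡ m = cong (_-ₚ T) (^ₚ≡^ T (card ℕ.^ m))

  Lp≡L : ∀ m → Lp m ≡ C.L m
  Lp≡L zero = refl
  Lp≡L (suc m) = cong₂ _*ₚ_ (bracket≡ (suc m)) (Lp≡L m)

  Dp≡D : ∀ m → Dp m ≡ C.D m
  Dp≡D zero = refl
  Dp≡D (suc m) = cong₂ _*ₚ_ (bracket≡ (suc m)) (trans (^ₚ≡^ (Dp m) card) (cong (_^ card) (Dp≡D m)))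

  sign : ∀ m → const (powC (- 1#) m * c) ≋ (-ₚ const 1#) ^ m *ₚ const c
  sign m = ≋-trans (const-* (powC (- 1#) m) c) (*ₚ-cong {g = const c}
    (≋-trans (A.reflexive (cong const (powC≡^ᶠ (- 1#) m))) (const-^ (- 1#) m)) ≋-refl)

  ∣ₚ⇔∣ : ∀ {f g g′} → g ≋ g′ → f ∣ₚ g ⇔ f D.∣ g′
  ∣ₚ⇔∣ e = mk⇔ (λ (h , hf≈g) → h D.,ᵈ ≋-trans (pointwise hf≈g) e) (λ { (h D.,ᵈ hf≋g) → h , coeffs (≋-trans hf≋g (≋-sym e)) })

  L-c : Lp n -ₚ const c ≋ C.L n -ₚ const c
  L-c = A.reflexive (cong (_-ₚ const c) (Lp≡L n))

  D+sc : Dp n +ₚ const (powC (- 1#) d * c) ≋ C.D n +ₚ (-ₚ const 1#) ^ d *ₚ const c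
  D+sc = +ₚ-cong (A.reflexive (Dp≡D n)) (sign d)

  deriv-eT : deriv (const e *ₚ T) ≋ const e
  deriv-eT = begin
    deriv (const e *ₚ T)       ≈⟨ δ.δ-*-constantˡ {const e} T ≋-refl ⟩
    const e *ₚ deriv T         ≈⟨ *ₚ-congʳ (const e) deriv-T ⟩
    const e *ₚ const 1#        ≈⟨ A.*-identityʳ (const e) ⟩
    const e                    ∎

  -- The derivative of ℘ is e exactly when ℘ - e T has derivative zero, that is, when ℘ - e T is a
  -- p-th power.
  deriv≈e⇔pth-power+eT : ∀ ℘ → (deriv ℘ ≈ₚ const e) ⇔ Σ P (λ a → ℘ ≈ₚ ((a ^ₚ p) +ₚ (const e *ₚ T)))
  deriv≈e⇔pth-power+eT ℘ = mk⇔ to from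
    where
    open IntegerSolver polynomial-ring
    recombine : ∀ x y → x ≋ (x -ₚ y) +ₚ y
    recombine = solve 2 (λ x y → x := (x :- y) :+ y) ≋-refl
    to : deriv ℘ ≈ₚ const e → Σ P (λ a → ℘ ≈ₚ ((a ^ₚ p) +ₚ (const e *ₚ T)))
    to δ℘≈e = let (a , rest≋a^p) = deriv≋[]⇒pth-power (℘ -ₚ const e *ₚ T) (begin
                    deriv (℘ -ₚ const e *ₚ T)           ≈⟨ δ.δ-sub ℘ (const e *ₚ T) ⟩
                    deriv ℘ -ₚ deriv (const e *ₚ T)     ≈⟨ +ₚ-cong {deriv ℘} {const e} (pointwise δ℘≈e) (-ₚ-cong deriv-eT) ⟩
                    const e -ₚ const e                  ≈⟨ +ₚ-inverseʳ (const e) ⟩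
                    []                                  ∎)
              in a , coeffs (begin
                    ℘                                          ≈⟨ recombine ℘ (const e *ₚ T) ⟩
                    (℘ -ₚ const e *ₚ T) +ₚ const e *ₚ T        ≈⟨ A.+-congʳ {const e *ₚ T} rest≋a^p ⟩
                    a ^ p +ₚ const e *ₚ T                      ≡⟨ cong (_+ₚ const e *ₚ T) (^ₚ≡^ a p) ⟨
                    (a ^ₚ p) +ₚ const e *ₚ T                   ∎)
    from : Σ P (λ a → ℘ ≈ₚ ((a ^ₚ p) +ₚ (const e *ₚ T))) → deriv ℘ ≈ₚ const e
    from (a , ℘≈) = coeffs (begin
      deriv ℘                                   ≈⟨ deriv-cong {℘} {(a ^ₚ p) +ₚ const e *ₚ T} (pointwise ℘≈) ⟩
      deriv ((a ^ₚ p) +ₚ const e *ₚ T)          ≈⟨ deriv-+ (a ^ₚ p) (const e *ₚ T) ⟩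
      deriv (a ^ₚ p) +ₚ deriv (const e *ₚ T)    ≡⟨ cong (λ f → deriv f +ₚ deriv (const e *ₚ T)) (^ₚ≡^ a p) ⟩
      deriv (a ^ p) +ₚ deriv (const e *ₚ T)     ≈⟨ +ₚ-cong (δ.δ-^-char p (natC≡0⇒·≋[] p natC-p) a) deriv-eT ⟩
      const e                                   ∎)

  module _ (℘ : P) (monic : MonicOfDegree d ℘) (irreducible : Irreducible ℘) where
    open IrreduciblePolynomial F 1<card d ℘ monic irreducible
      using (℘∤1; ∣-or-coprime; residues; residues-separated; residues-length)

    private
      v : Vec Carrier d
      v = proj₁ (monic-vector d ℘ monic)

      consts-fixed : ∀ {m} (w : Vec Carrier m) → VecAll.All (λ f → f ^ card ≋ f) (Vec.map const w)
      consts-fixed [] = VecAll.[]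
      consts-fixed (a ∷ w) = const-fermat a VecAll.∷ consts-fixed w

      module Q = C.PrimeModulus ℘ n (Vec.map const v) (consts-fixed v) (proj₂ (monic-vector d ℘ monic)) ℘∤1 ∣-or-coprime
        residues residues-separated residues-length (λ m ℘∣ → All.universal (fixed-mod m ℘∣) residues)

      ℘∤c : ¬ ℘ D.∣ const c
      ℘∤c ℘∣c = let (u , cu≋1) = const-unit c c≢0 in ℘∤1 (D.∣-resp cu≋1 (D.∣-*ʳ u ℘∣c))

      module R = Q.Derived deriv deriv-isDerivation deriv-T (natC≡0⇒·≋[] card natC-card)
      module E = R.Translated (const c) (const-fermat c) ℘∤c ≋-refl

      -- A multiple of ℘ of degree below d is zero, so for ℘′ and a constant, congruence modulo ℘ is
      -- equality.
      ℘∣δ℘-e⇔ : ℘ D.∣ deriv ℘ -ₚ ((-ₚ const 1#) ^ n *ₚ const c) ⇔ (deriv ℘ ≈ₚ const e)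
      ℘∣δ℘-e⇔ = mk⇔
        (λ ℘∣ → coeffs (≋-from-sub {deriv ℘} {const e} (multiple-small⇒≋[] monic
          (D.∣-resp (A.+-congˡ {deriv ℘} (-ₚ-cong (≋-sym (sign n)))) ℘∣) small)))
        (λ δ℘≈e → D.∣-resp (≋-sym (≋-trans (+ₚ-cong {deriv ℘} {const e} (pointwise δ℘≈e) (-ₚ-cong (≋-sym (sign n)))) (+ₚ-inverseʳ (const e)))) D.∣0)
        where
        small : DegLt d (deriv ℘ -ₚ const e)
        small = degLt-sub {d} {deriv ℘} {const e}
          (λ i d≤i → trans (coeff-deriv ℘ i) (trans (cong (natC (suc i) *_) (proj₂ monic (suc i) (s≤s d≤i))) (K.zeroʳ _)))
          (λ { (suc i) _ → refl })

    L⇔D : (℘ ∣ₚ (Lp n -ₚ const c)) ⇔ (℘ ∣ₚ (Dp n +ₚ const (powC (- 1#) d * c)))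
    L⇔D = ⇔-sym (∣ₚ⇔∣ D+sc) ⇔-∘ (E.L≡e⇔D≡e ⇔-∘ ∣ₚ⇔∣ L-c)

    L⇔deriv : (℘ ∣ₚ (Lp n -ₚ const c)) ⇔ (deriv ℘ ≈ₚ const e)
    L⇔deriv = ℘∣δ℘-e⇔ ⇔-∘ (E.L≡e⇔δ℘≡e ⇔-∘ ∣ₚ⇔∣ L-c)

    -- Compare the coefficients of T^n in ℘′ = e: on the left it is d, as ℘ is monic, and on the
    -- right it is 0, as n > 0.
    p∣degree : ℘ ∣ₚ (Lp n -ₚ const c) → p ∣ℕ d
    p∣degree ℘∣ = natC≡0⇒∣ p-prime natC-p
      (trans (sym (K.*-identityʳ (natC d))) (trans (cong (natC d *_) (sym (proj₁ monic)))
        (trans (sym (coeff-deriv ℘ n)) (Equivalence.to L⇔deriv ℘∣ n))))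

    L-multiplicity : ℘ ∣ₚ (Lp n -ₚ const c) → (℘ ^ₚ p-1) ∣ₚ (Lp n -ₚ const c)
    L-multiplicity ℘∣ = let (a , ℘≈) = Equivalence.to (deriv≈e⇔pth-power+eT ℘) (Equivalence.to L⇔deriv ℘∣) in
      Equivalence.from (∣ₚ⇔∣ L-c) (subst (D._∣ (C.L n -ₚ const c)) (sym (^ₚ≡^ ℘ p-1))
        (E.L-multiplicity a (monic-regular {g = ℘} monic) additive-p p≤card
          (≋-trans (pointwise ℘≈) (+ₚ-cong (A.reflexive (^ₚ≡^ a p)) (*ₚ-cong {g = T} (sign n) ≋-refl)))))

    D-multiplicity : ¬ ((℘ ^ₚ 2) ∣ₚ (Dp n +ₚ const (powC (- 1#) d * c)))
    D-multiplicity ℘²∣ = E.D-multiplicity (s≤s z≤n) (Equivalence.to (∣ₚ⇔∣ D+sc) ℘²∣)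

open import Data.Nat.Divisibility using (_∣_)

theorem7 : (F : FiniteField) → let open FiniteField F in let open Poly F in
    (p : ℕ) → Prime p → natC p ≡ 0# →
    (d : ℕ) → 1 < d → (c : Carrier) → c ≢ 0# →
    ((℘ : P) → MonicOfDegree d ℘ → Irreducible ℘ →
    ((℘ ∣ₚ (Lp (d ∸ 1) -ₚ const c)) ⇔ (℘ ∣ₚ (Dp (d ∸ 1) +ₚ const (powC (- 1#) d * c))))
    × ((℘ ∣ₚ (Lp (d ∸ 1) -ₚ const c)) ⇔ (deriv ℘ ≈ₚ const (powC (- 1#) (d ∸ 1) * c)))
    × ((deriv ℘ ≈ₚ const (powC (- 1#) (d ∸ 1) * c))
    ⇔ Σ P (λ a → ℘ ≈ₚ ((a ^ₚ p) +ₚ (const (powC (- 1#) (d ∸ 1) * c) *ₚ T)))))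
    × (Σ P (λ ℘ → MonicOfDegree d ℘ × Irreducible ℘ × (℘ ∣ₚ (Lp (d ∸ 1) -ₚ const c))) → p ∣ d)
    × ((℘ : P) → MonicOfDegree d ℘ → Irreducible ℘ → (℘ ∣ₚ (Lp (d ∸ 1) -ₚ const c)) →
    ((℘ ^ₚ (p ∸ 1)) ∣ₚ (Lp (d ∸ 1) -ₚ const c))
    × (℘ ∣ₚ (Dp (d ∸ 1) +ₚ const (powC (- 1#) d * c)))
    × ¬ ((℘ ^ₚ 2) ∣ₚ (Dp (d ∸ 1) +ₚ const (powC (- 1#) d * c))))
theorem7 F zero p-prime = ⊥-elim (ℕₚ.n≮0 (ℕ.nonTrivial⇒n>1 0 {{prime⇒nonTrivial p-prime}}))
theorem7 F (suc p-1) p-prime natC-p (suc zero) (s≤s ())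
theorem7 F (suc p-1) p-prime natC-p (suc (suc k)) _ c c≢0 =
    (λ ℘ monic irr → L⇔D ℘ monic irr , L⇔deriv ℘ monic irr , deriv≈e⇔pth-power+eT ℘)
  , (λ (℘ , monic , irr , ℘∣L) → p∣degree ℘ monic irr ℘∣L)
  , λ ℘ monic irr ℘∣L →
      L-multiplicity ℘ monic irr ℘∣L
    , Equivalence.to (L⇔D ℘ monic irr) ℘∣L
    , D-multiplicity ℘ monic irr
  where open FixedDerivativePrimes F p-1 p-prime natC-p k c c≢0
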